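{- Let $k \geq l$ be positive integers with $k \geq 2$, and let $A \subset \mathbb{N}$ be such that the set $A^k + A^l$ has positive lower density. Then there is a constant $C>0$ such that for infinitely many positive integers $X$, $$A(X) \geq C\,\frac{\sqrt{X}}{(\log X)^{\alpha(k,l)}}, \qquad \text{where } \alpha(k,l) = \frac{k+l-2}{k+l}.$$
   Context: $\mathbb{N}$ denotes the set of positive integers. For sets $A,B$ of integers, $AB=\{ab: a\in A, b\in B\}$, $A+B=\{a+b: a\in A,b\in B\}$, $A^1=A$ and $A^k = A A^{k-1}$ for $k>1$. For $A\subset\mathbb{N}_0$ and $X>0$, $A(X)=|A\cap[1,X]|$. The lower density of $A$ is $\liminf_{X\to\infty} A(X)/X$. -}

module Defs where

open import Level using (0ℓ)
open import Data.Fin as Fin using (Fin; toℕ)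
import Data.Fin.Properties as Fin
import Data.Integer as ℤ
import Data.Integer.Properties as ℤ
open import Data.Nat as ℕ using (ℕ; zero; suc; NonZero; s≤s; z≤n)
import Data.Nat.Properties as ℕ
open import Data.Product using (Σ; ∃; ∃₂; Σ-syntax; ∃-syntax; _×_; _,_; proj₁; proj₂)
open import Data.Rational as ℚ using (ℚ; 0ℚ; 1ℚ; _/_)
import Data.Rational.Properties as ℚ
import Data.Rational.Unnormalised as ℚᵘ
import Data.Rational.Unnormalised.Properties as ℚᵘ
open import Data.Sum using (inj₁; inj₂)
open import Function.Base using (_∘_)
open import Function.Definitions using (Injective)
open import Relation.Binary.PropositionalEquality
open import Relation.Nullary using (¬_)
open import Relation.Unary using (Pred; _∈_; _∉_; _⊆_)
open import Algebra.Definitions.RawSemiring ℚ.+-*-rawSemiring using (sum; _^_)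

fromℕ : ℕ → ℚ
fromℕ n = ℤ.+ n / 1

module Auxiliary where

  infixr 4 _<⟫_

  _<⟫_ : ∀ {p q r} → p ℚ.< q → q ℚ.< r → p ℚ.< r
  _<⟫_ = ℚ.<-trans

  *-monoʳ : ∀ {p q r} → 0ℚ ℚ.≤ r → p ℚ.≤ q → r ℚ.* p ℚ.≤ r ℚ.* q
  *-monoʳ {r = r} 0≤r = ℚ.*-monoˡ-≤-nonNeg r {{ℚ.nonNegative 0≤r}}

  *-monoˡ : ∀ {p q r} → 0ℚ ℚ.≤ r → p ℚ.≤ q → p ℚ.* r ℚ.≤ q ℚ.* r
  *-monoˡ {r = r} 0≤r = ℚ.*-monoʳ-≤-nonNeg r {{ℚ.nonNegative 0≤r}}

  *-mono : ∀ {p q r s} → 0ℚ ℚ.≤ p → 0ℚ ℚ.≤ s → p ℚ.≤ q → r ℚ.≤ s → p ℚ.* r ℚ.≤ q ℚ.* s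
  *-mono 0≤p 0≤s p≤q r≤s = ℚ.≤-trans (*-monoʳ 0≤p r≤s) (*-monoˡ 0≤s p≤q)

  *-monoˡ-< : ∀ {p q r} → 0ℚ ℚ.< r → p ℚ.< q → p ℚ.* r ℚ.< q ℚ.* r
  *-monoˡ-< {r = r} 0<r = ℚ.*-monoˡ-<-pos r {{ℚ.positive 0<r}}

  *-cancelʳ-< : ∀ {p q r} → 0ℚ ℚ.< r → p ℚ.* r ℚ.< q ℚ.* r → p ℚ.< q
  *-cancelʳ-< {r = r} 0<r =
    ℚ.*-cancelʳ-<-nonNeg r {{ℚ.pos⇒nonNeg r {{ℚ.positive 0<r}}}}

  *-pos : ∀ {p q} → 0ℚ ℚ.< p → 0ℚ ℚ.< q → 0ℚ ℚ.< p ℚ.* q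
  *-pos {p} {q} 0<p 0<q =
    ℚ.positive⁻¹ _ {{ℚ.pos*pos⇒pos p {{ℚ.positive 0<p}} q {{ℚ.positive 0<q}}}}

  ÷-exists : ∀ p {s} → 0ℚ ℚ.< s → ∃[ t ] t ℚ.* s ≡ p
  ÷-exists p {s} 0<s = p ℚ.* ℚ.1/ s ,
    trans (ℚ.*-assoc p (ℚ.1/ s) s)
      (trans (cong (p ℚ.*_) (ℚ.*-inverseˡ s)) (ℚ.*-identityʳ p))
    where instance _ = ℚ.>-nonZero 0<s

  ÷-between : ∀ {p r s} → 0ℚ ℚ.< s → p ℚ.* s ℚ.< r → ∃[ t ] p ℚ.< t × t ℚ.* s ℚ.< r
  ÷-between 0<s ps<r with m , ps<m , m<r ← ℚ.<-dense ps<r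
    with t , refl ← ÷-exists m 0<s = t , *-cancelʳ-< 0<s ps<m , m<r

  0<1 : 0ℚ ℚ.< 1ℚ
  0<1 = ℚ.positive⁻¹ 1ℚ

  0≤1 : 0ℚ ℚ.≤ 1ℚ
  0≤1 = ℚ.<⇒≤ 0<1

  -1<0 : ℚ.- 1ℚ ℚ.< 0ℚ
  -1<0 = ℚ.negative⁻¹ (ℚ.- 1ℚ)

  ^-nonNeg : ∀ {x} n → 0ℚ ℚ.≤ x → 0ℚ ℚ.≤ x ^ n
  ^-nonNeg zero    0≤x = 0≤1
  ^-nonNeg {x} (suc n) 0≤x =
    subst (ℚ._≤ x ℚ.* x ^ n) (ℚ.*-zeroʳ x) (*-monoʳ 0≤x (^-nonNeg n 0≤x))

  ^-pos : ∀ {x} n → 0ℚ ℚ.< x → 0ℚ ℚ.< x ^ n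
  ^-pos zero    0<x = 0<1
  ^-pos (suc n) 0<x = *-pos 0<x (^-pos n 0<x)

  ^-mono : ∀ {x y} n → 0ℚ ℚ.≤ x → x ℚ.≤ y → x ^ n ℚ.≤ y ^ n
  ^-mono zero    0≤x x≤y = ℚ.≤-refl
  ^-mono (suc n) 0≤x x≤y =
    *-mono 0≤x (^-nonNeg n (ℚ.≤-trans 0≤x x≤y)) x≤y (^-mono n 0≤x x≤y)

  1^ : ∀ n → 1ℚ ^ n ≡ 1ℚ
  1^ zero    = refl
  1^ (suc n) = trans (ℚ.*-identityˡ _) (1^ n)

  1≤^ : ∀ {x} n → 1ℚ ℚ.≤ x → 1ℚ ℚ.≤ x ^ n
  1≤^ {x} n 1≤x = subst (ℚ._≤ x ^ n) (1^ n) (^-mono n 0≤1 1≤x)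

  ^≤1 : ∀ {x} n → 0ℚ ℚ.≤ x → x ℚ.≤ 1ℚ → x ^ n ℚ.≤ 1ℚ
  ^≤1 {x} n 0≤x x≤1 = subst (x ^ n ℚ.≤_) (1^ n) (^-mono n 0≤x x≤1)

  x≤x^ : ∀ {x} n .{{_ : NonZero n}} → 1ℚ ℚ.≤ x → x ℚ.≤ x ^ n
  x≤x^ {x} (suc n) 1≤x = subst (ℚ._≤ x ℚ.* x ^ n) (ℚ.*-identityʳ x)
    (*-monoʳ (ℚ.≤-trans 0≤1 1≤x) (1≤^ n 1≤x))

  x^≤x : ∀ {x} n .{{_ : NonZero n}} → 0ℚ ℚ.≤ x → x ℚ.≤ 1ℚ → x ^ n ℚ.≤ x
  x^≤x {x} (suc n) 0≤x x≤1 = subst (x ℚ.* x ^ n ℚ.≤_) (ℚ.*-identityʳ x)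
    (*-monoʳ 0≤x (^≤1 n 0≤x x≤1))

  fromℚᵘ-≤ : ∀ {p q} → p ℚᵘ.≤ q → ℚ.fromℚᵘ p ℚ.≤ ℚ.fromℚᵘ q
  fromℚᵘ-≤ {p} {q} p≤q = ℚ.toℚᵘ-cancel-≤
    (ℚᵘ.≤-respˡ-≃ (ℚᵘ.≃-sym (ℚ.toℚᵘ-fromℚᵘ p))
      (ℚᵘ.≤-respʳ-≃ (ℚᵘ.≃-sym (ℚ.toℚᵘ-fromℚᵘ q)) p≤q))

  int : ℕ → ℚᵘ.ℚᵘ
  int n = ℚᵘ.mkℚᵘ (ℤ.+ n) 0

  fromℕ-mono : ∀ {m n} → m ℕ.≤ n → fromℕ m ℚ.≤ fromℕ n
  fromℕ-mono {m} {n} m≤n = fromℚᵘ-≤ {int m} {int n} (ℚᵘ.*≤* (ℤ.*-monoʳ-≤-nonNeg (ℤ.+ 1) (ℤ.+≤+ m≤n)))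

  fromℕ-suc : ∀ n → fromℕ (suc n) ≡ 1ℚ ℚ.+ fromℕ n
  fromℕ-suc n = ℚ.toℚᵘ-injective (ℚᵘ.≃-trans (ℚ.toℚᵘ-fromℚᵘ (int (suc n))) (ℚᵘ.≃-sym
    (ℚᵘ.≃-trans (ℚ.toℚᵘ-homo-+ 1ℚ (fromℕ n))
      (ℚᵘ.≃-trans (ℚᵘ.+-congʳ ℚᵘ.1ℚᵘ (ℚ.toℚᵘ-fromℚᵘ (int n)))
        (ℚᵘ.*≡* (cong (λ z → (ℤ.+ 1 ℤ.+ z) ℤ.* ℤ.+ 1) (ℤ.*-identityʳ (ℤ.+ n))))))))

  fromℕ-< : ∀ {m n} → m ℕ.< n → fromℕ m ℚ.< fromℕ n
  fromℕ-< {m} m<n = ℚ.<-≤-trans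
    (subst₂ ℚ._<_ (ℚ.+-identityˡ _) (sym (fromℕ-suc m)) (ℚ.+-monoˡ-< (fromℕ m) 0<1))
    (fromℕ-mono m<n)

  fromℕ-<⁻¹ : ∀ {m n} → fromℕ m ℚ.< fromℕ n → m ℕ.< n
  fromℕ-<⁻¹ m<n = ℕ.≰⇒> λ n≤m → ℚ.<-irrefl refl (ℚ.<-≤-trans m<n (fromℕ-mono n≤m))

  fromℕ-pos : ∀ n .{{_ : NonZero n}} → 0ℚ ℚ.< fromℕ n
  fromℕ-pos n = fromℕ-< (ℕ.>-nonZero⁻¹ n)

  unit-fraction : ∀ n → fromℕ (suc n) ℚ.* (ℤ.+ 1 / suc n) ≡ 1ℚ
  unit-fraction n = ℚ.toℚᵘ-injective
    (ℚᵘ.≃-trans (ℚ.toℚᵘ-homo-* (fromℕ (suc n)) (ℤ.+ 1 / suc n))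
      (ℚᵘ.≃-trans (ℚᵘ.*-cong (ℚ.toℚᵘ-fromℚᵘ (int (suc n)))
                            (ℚ.toℚᵘ-fromℚᵘ (ℚᵘ.mkℚᵘ (ℤ.+ 1) n)))
        (ℚᵘ.*-inverseʳ (int (suc n)))))

  unit : ℕ → ℚ
  unit n = ℤ.+ 1 / suc n

  unit-pos : ∀ n → 0ℚ ℚ.< unit n
  unit-pos n = ℚ.positive⁻¹ _ {{ℚ.normalize-pos 1 (suc n)}}

  sum-nonNeg : ∀ m {f : Fin m → ℚ} → (∀ i → 0ℚ ℚ.< f i) → 0ℚ ℚ.≤ sum f
  sum-nonNeg zero    0<f = ℚ.≤-refl
  sum-nonNeg (suc m) 0<f =
    ℚ.+-mono-≤ (ℚ.<⇒≤ (0<f Fin.zero)) (sum-nonNeg m (0<f ∘ Fin.suc))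

  sum-pos : ∀ m {f : Fin m → ℚ} → 0 ℕ.< m → (∀ i → 0ℚ ℚ.< f i) → 0ℚ ℚ.< sum f
  sum-pos (suc m) _ 0<f = ℚ.+-mono-<-≤ (0<f Fin.zero) (sum-nonNeg m (0<f ∘ Fin.suc))

  sum-≤ : ∀ m {f : Fin m → ℚ} {c} → (∀ i → f i ℚ.≤ c) → sum f ℚ.≤ fromℕ m ℚ.* c
  sum-≤ zero    {c = c} f≤c = ℚ.≤-reflexive (sym (ℚ.*-zeroˡ c))
  sum-≤ (suc m) {c = c} f≤c = ℚ.≤-trans (ℚ.+-mono-≤ (f≤c Fin.zero) (sum-≤ m (f≤c ∘ Fin.suc)))
    (ℚ.≤-reflexive (sym (trans (cong (ℚ._* c) (fromℕ-suc m))
      (trans (ℚ.*-distribʳ-+ c 1ℚ (fromℕ m)) (cong (ℚ._+ fromℕ m ℚ.* c) (ℚ.*-identityˡ c))))))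

  fromℕ-* : ∀ m n → fromℕ (m ℕ.* n) ≡ fromℕ m ℚ.* fromℕ n
  fromℕ-* m n = ℚ.toℚᵘ-injective (ℚᵘ.≃-trans (ℚ.toℚᵘ-fromℚᵘ (int (m ℕ.* n))) (ℚᵘ.≃-sym
    (ℚᵘ.≃-trans (ℚ.toℚᵘ-homo-* (fromℕ m) (fromℕ n))
      (ℚᵘ.≃-trans (ℚᵘ.*-cong (ℚ.toℚᵘ-fromℚᵘ (int m)) (ℚ.toℚᵘ-fromℚᵘ (int n)))
        (ℚᵘ.*≡* (cong (ℤ._* ℤ.+ 1) (sym (ℤ.pos-* m n))))))))

  unit-≤ : ∀ {m n} → m ℕ.≤ n → unit n ℚ.≤ unit m
  unit-≤ {m} {n} m≤n = fromℚᵘ-≤ {ℚᵘ.mkℚᵘ (ℤ.+ 1) n} {ℚᵘ.mkℚᵘ (ℤ.+ 1) m} (ℚᵘ.*≤* (ℤ.*-monoˡ-≤-nonNeg (ℤ.+ 1) (ℤ.+≤+ (s≤s m≤n))))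

open Auxiliary

-- Dedekind cuts of ℚ, a real being identified with the set of rationals
-- strictly below it.

record ℝ : Set₁ where
  field
    cut       : Pred ℚ 0ℓ
    inhabited : ∃ cut
    proper    : ∃[ p ] p ∉ cut
    lower     : ∀ {p q} → p ℚ.< q → q ∈ cut → p ∈ cut
    open′     : ∀ {p} → p ∈ cut → ∃[ q ] p ℚ.< q × q ∈ cut

open ℝ public using (cut)

infix 4 _≤_ _<_

_≤_ _<_ : ℝ → ℝ → Set
x ≤ y = cut x ⊆ cut y
x < y = ∃[ p ] p ∈ cut y × p ∉ cut x

fromℚ : ℚ → ℝ
fromℚ q = record
  { cut       = ℚ._< q
  ; inhabited = q ℚ.- 1ℚ , subst (q ℚ.- 1ℚ ℚ.<_) (ℚ.+-identityʳ q) (ℚ.+-monoʳ-< q -1<0)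
  ; proper    = q , ℚ.<-irrefl refl
  ; lower     = ℚ.<-trans
  ; open′     = λ p<q → let r , p<r , r<q = ℚ.<-dense p<q in r , p<r , r<q
  }

0ℝ : ℝ
0ℝ = fromℚ 0ℚ

record ℝ⁺ : Set₁ where
  field
    real     : ℝ
    positive : 0ℚ ∈ cut real

  open ℝ real using (proper; lower; open′)

  upper : ∃[ b ] (0ℚ ℚ.< b) × (∀ {p} → p ∈ cut real → p ℚ.< b)
  upper with b , b∉ ← proper = b , above positive , above
    where
    above : ∀ {p} → p ∈ cut real → p ℚ.< b
    above {p} p∈ with q , p<q , q∈ ← open′ p∈ = ℚ.≰⇒> λ b≤p → b∉ (lower (ℚ.≤-<-trans b≤p p<q) q∈)

  positive-∉ : ∀ {s} → s ∉ cut real → 0ℚ ℚ.< s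
  positive-∉ s∉ with q , 0<q , q∈ ← open′ positive =
    ℚ.≰⇒> λ s≤0 → s∉ (lower (ℚ.≤-<-trans s≤0 0<q) q∈)

open ℝ⁺ public using (real)

infixl 7 _*_ _÷_
infixr 8 _^[_/_]

_*_ : ℝ⁺ → ℝ⁺ → ℝ⁺
x * y = record { real = xy ; positive = 0∈ }
  where
  module x = ℝ⁺ x
  module y = ℝ⁺ y

  xy-cut : Pred ℚ 0ℓ
  xy-cut p = ∃₂ λ r s → (r ∈ cut x.real × 0ℚ ℚ.< r) × (s ∈ cut y.real × 0ℚ ℚ.< s) × p ℚ.< r ℚ.* s

  0∈ : 0ℚ ∈ xy-cut
  0∈ with r , 0<r , r∈ ← ℝ.open′ x.real x.positive | s , 0<s , s∈ ← ℝ.open′ y.real y.positive =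
    r , s , (r∈ , 0<r) , (s∈ , 0<s) , *-pos 0<r 0<s

  xy : ℝ
  xy = record
    { cut       = xy-cut
    ; inhabited = 0ℚ , 0∈
    ; proper    = let a , 0<a , <a = x.upper ; b , 0<b , <b = y.upper in
                  a ℚ.* b , λ (r , s , (r∈ , 0<r) , (s∈ , 0<s) , ab<rs) →
                  ℚ.<-irrefl refl (ℚ.<-≤-trans ab<rs
                    (*-mono (ℚ.<⇒≤ 0<r) (ℚ.<⇒≤ 0<b) (ℚ.<⇒≤ (<a r∈)) (ℚ.<⇒≤ (<b s∈))))
    ; lower     = λ p<q (r , s , r∈ , s∈ , q<rs) → r , s , r∈ , s∈ , (p<q <⟫ q<rs)
    ; open′     = λ (r , s , r∈ , s∈ , p<rs) →
                  let q , p<q , q<rs = ℚ.<-dense p<rs in q , p<q , r , s , r∈ , s∈ , q<rs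
    }

-- An upper bound s of y is taken as a rational outside the cut of y:
-- p < x / y  iff  p s < r  for some rational r < x and s ≥ y.

_÷_ : ℝ⁺ → ℝ⁺ → ℝ⁺
x ÷ y = record { real = x/y ; positive = 0∈ }
  where
  module x = ℝ⁺ x
  module y = ℝ⁺ y

  x/y-cut : Pred ℚ 0ℓ
  x/y-cut p = ∃₂ λ r s → r ∈ cut x.real × s ∉ cut y.real × p ℚ.* s ℚ.< r

  0∈ : 0ℚ ∈ x/y-cut
  0∈ with r , 0<r , r∈ ← ℝ.open′ x.real x.positive | s , s∉ ← ℝ.proper y.real =
    r , s , r∈ , s∉ , subst (ℚ._< r) (sym (ℚ.*-zeroˡ s)) 0<r

  bound : ∃[ p ] p ∉ x/y-cut
  bound with a , 0<a , <a ← x.upper | b , 0<b , b∈ ← ℝ.open′ y.real y.positive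
    with t , tb≡a ← ÷-exists a 0<b = t , λ (r , s , r∈ , s∉ , ts<r) →
      ℚ.<-irrefl refl (<a r∈ <⟫ subst (ℚ._< r) tb≡a (ℚ.≤-<-trans
        (*-monoʳ {r = t} (0≤t {t} tb≡a 0<a 0<b) (ℚ.≮⇒≥ λ s<b → s∉ (ℝ.lower y.real s<b b∈))) ts<r))
    where
    0≤t : ∀ {t a b} → t ℚ.* b ≡ a → 0ℚ ℚ.< a → 0ℚ ℚ.< b → 0ℚ ℚ.≤ t
    0≤t {t} {b = b} refl 0<tb 0<b =
      ℚ.<⇒≤ (*-cancelʳ-< {0ℚ} {t} 0<b (subst (ℚ._< t ℚ.* b) (sym (ℚ.*-zeroˡ b)) 0<tb))

  x/y : ℝ
  x/y = record
    { cut       = x/y-cut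
    ; inhabited = 0ℚ , 0∈
    ; proper    = bound
    ; lower     = λ p<q (r , s , r∈ , s∉ , qs<r) →
                  r , s , r∈ , s∉ , (*-monoˡ-< (y.positive-∉ s∉) p<q <⟫ qs<r)
    ; open′     = λ (r , s , r∈ , s∉ , ps<r) →
                  let t , p<t , ts<r = ÷-between (y.positive-∉ s∉) ps<r
                  in t , p<t , r , s , r∈ , s∉ , ts<r
    }

-- The real power x^(a/b):  p < x^(a/b)  iff  p < q  for some q > 0 with
-- q^b ≤ r^a, where 0 < r < x.

_^[_/_] : ℝ⁺ → (a b : ℕ) → .{{NonZero b}} → ℝ⁺
x ^[ a / b ] = record { real = x^ ; positive = 0∈ }
  where
  module x = ℝ⁺ x

  x^-cut : Pred ℚ 0ℓ
  x^-cut p = ∃₂ λ q r → 0ℚ ℚ.< q × (r ∈ cut x.real × 0ℚ ℚ.< r) × q ^ b ℚ.≤ r ^ a × p ℚ.< q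

  0∈ : 0ℚ ∈ x^-cut
  0∈ with r , 0<r , r∈ ← ℝ.open′ x.real x.positive = s ^ a , r , ^-pos a 0<s , (r∈ , 0<r) ,
    ℚ.≤-trans (x^≤x b (ℚ.<⇒≤ (^-pos a 0<s)) (^≤1 a (ℚ.<⇒≤ 0<s) (ℚ.p⊓q≤p 1ℚ r)))
              (^-mono a (ℚ.<⇒≤ 0<s) (ℚ.p⊓q≤q 1ℚ r)) ,
    ^-pos a 0<s
    where
    s = 1ℚ ℚ.⊓ r
    0<s : 0ℚ ℚ.< s
    0<s with ℚ.⊓-sel 1ℚ r
    ... | inj₁ eq = subst (0ℚ ℚ.<_) (sym eq) 0<1
    ... | inj₂ eq = subst (0ℚ ℚ.<_) (sym eq) 0<r

  bound : ∃[ p ] p ∉ x^-cut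
  bound with c , 0<c , <c ← x.upper = (1ℚ ℚ.⊔ c) ^ a , λ (q , r , 0<q , (r∈ , 0<r) , q^≤r^ , M<q) →
    ℚ.<-irrefl refl (ℚ.<-≤-trans M<q
      (ℚ.≤-trans (x≤x^ b (ℚ.≤-trans (1≤^ a (ℚ.p≤p⊔q 1ℚ c)) (ℚ.<⇒≤ M<q)))
        (ℚ.≤-trans q^≤r^
          (^-mono a (ℚ.<⇒≤ 0<r) (ℚ.≤-trans (ℚ.<⇒≤ (<c r∈)) (ℚ.p≤q⊔p 1ℚ c))))))

  x^ : ℝ
  x^ = record
    { cut       = x^-cut
    ; inhabited = 0ℚ , 0∈
    ; proper    = bound
    ; lower     = λ p<p′ (q , r , 0<q , r∈ , q^≤r^ , p′<q) →
                  q , r , 0<q , r∈ , q^≤r^ , (p<p′ <⟫ p′<q)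
    ; open′     = λ (q , r , 0<q , r∈ , q^≤r^ , p<q) →
                  let p′ , p<p′ , p′<q = ℚ.<-dense p<q
                  in p′ , p<p′ , q , r , 0<q , r∈ , q^≤r^ , p′<q
    }

√_ : ℝ⁺ → ℝ⁺
√ x = x ^[ 1 / 2 ]

fromℕ⁺ : (n : ℕ) → 0 ℕ.< n → ℝ⁺
fromℕ⁺ n 0<n = record { real = fromℚ (fromℕ n) ; positive = fromℕ-< 0<n }

instance
  +-nonZero : ∀ {k l} .{{_ : NonZero k}} → NonZero (k ℕ.+ l)
  +-nonZero {suc k} = _

-- The lower Darboux sum of ∫₁ˣ dt/t for the partition of [1, X] into
-- intervals of length 1/N: on [(N+i)/N, (N+i+1)/N] the infimum of 1/t is
-- N/(N+i+1), so that interval contributes 1/(N+i+1).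

lowerSum : (X N : ℕ) → ℚ
lowerSum X N = sum {N ℕ.* (X ℕ.∸ 1)} λ i → ℤ.+ 1 / suc (N ℕ.+ toℕ i)

-- The natural logarithm log X = ∫₁ˣ dt/t, as the supremum of these sums.

log : (X : ℕ) → 1 ℕ.< X → ℝ⁺
log X 1<X = record { real = logX ; positive = 0∈ }
  where
  log-cut : Pred ℚ 0ℓ
  log-cut p = Σ[ N ∈ ℕ ] 1 ℕ.≤ N × p ℚ.< lowerSum X N

  lowerSum-≤ : ∀ N → 1 ℕ.≤ N → lowerSum X N ℚ.≤ fromℕ (X ℕ.∸ 1)
  lowerSum-≤ (suc n) _ = ℚ.≤-trans
    (sum-≤ (suc n ℕ.* x) {c = unit n} λ i → unit-≤ (ℕ.≤-trans (ℕ.n≤1+n n) (ℕ.m≤m+n (suc n) (toℕ i))))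
    (ℚ.≤-reflexive (begin
      fromℕ (suc n ℕ.* x) ℚ.* unit n            ≡⟨ cong (λ m → fromℕ m ℚ.* unit n) (ℕ.*-comm (suc n) x) ⟩
      fromℕ (x ℕ.* suc n) ℚ.* unit n            ≡⟨ cong (ℚ._* unit n) (fromℕ-* x (suc n)) ⟩
      fromℕ x ℚ.* fromℕ (suc n) ℚ.* unit n      ≡⟨ ℚ.*-assoc (fromℕ x) (fromℕ (suc n)) (unit n) ⟩
      fromℕ x ℚ.* (fromℕ (suc n) ℚ.* unit n)    ≡⟨ cong (fromℕ x ℚ.*_) (unit-fraction n) ⟩
      fromℕ x ℚ.* 1ℚ                            ≡⟨ ℚ.*-identityʳ (fromℕ x) ⟩
      fromℕ x                                   ∎))
    where
    open ≡-Reasoning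
    x = X ℕ.∸ 1

  0∈ : 0ℚ ∈ log-cut
  0∈ = 1 , ℕ.≤-refl ,
    sum-pos (1 ℕ.* (X ℕ.∸ 1)) (subst (0 ℕ.<_) (sym (ℕ.*-identityˡ (X ℕ.∸ 1))) (ℕ.m<n⇒0<n∸m 1<X))
      λ i → unit-pos (1 ℕ.+ toℕ i)

  logX : ℝ
  logX = record
    { cut       = log-cut
    ; inhabited = 0ℚ , 0∈
    ; proper    = fromℕ (X ℕ.∸ 1) , λ (N , 1≤N , <sum) →
                  ℚ.<-irrefl refl (ℚ.<-≤-trans <sum (lowerSum-≤ N 1≤N))
    ; lower     = λ p<q (N , 1≤N , q<) → N , 1≤N , (p<q <⟫ q<)
    ; open′     = λ (N , 1≤N , p<) →
                  let q , p<q , q< = ℚ.<-dense p< in q , p<q , N , 1≤N , q<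
    }

infixl 7 _·_
infixl 6 _⊕_

_·_ _⊕_ : Pred ℕ 0ℓ → Pred ℕ 0ℓ → Pred ℕ 0ℓ
(A · B) n = ∃₂ λ a b → a ∈ A × b ∈ B × n ≡ a ℕ.* b
(A ⊕ B) n = ∃₂ λ a b → a ∈ A × b ∈ B × n ≡ a ℕ.+ b

infixr 8 _^ˢ_

_^ˢ_ : Pred ℕ 0ℓ → (k : ℕ) → .{{NonZero k}} → Pred ℕ 0ℓ
A ^ˢ suc zero    = A
A ^ˢ suc (suc k) = A · A ^ˢ suc k

-- |A ∩ [1, X]| as the real number sup { m : A ∩ [1, X] has m distinct
-- elements }.  Membership in A need not be decidable, so there is no function
-- returning this cardinality as a natural number.

∣_∩[1,_]∣ : Pred ℕ 0ℓ → ℕ → ℝ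
∣ A ∩[1, X ]∣ = record
  { cut       = card-cut
  ; inhabited = ℚ.- 1ℚ , 0 , ((λ ()) , (λ { {()} }) , λ ()) , -1<0
  ; proper    = fromℕ X , λ (m , (f , f-inj , f∈) , X<m) → too-many f f-inj (proj₁ ∘ f∈) (fromℕ-<⁻¹ X<m)
  ; lower     = λ p<q (m , f , q<m) → m , f , (p<q <⟫ q<m)
  ; open′     = λ (m , f , p<m) → let q , p<q , q<m = ℚ.<-dense p<m in q , p<q , m , f , q<m
  }
  where
  card-cut : Pred ℚ 0ℓ
  card-cut p = Σ[ m ∈ ℕ ]
    (Σ[ f ∈ (Fin m → ℕ) ] Injective _≡_ _≡_ f × (∀ i → (1 ℕ.≤ f i × f i ℕ.≤ X) × f i ∈ A))
    × p ℚ.< fromℕ m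

  pred-inj : ∀ {m n} → 1 ℕ.≤ m → 1 ℕ.≤ n → ℕ.pred m ≡ ℕ.pred n → m ≡ n
  pred-inj {suc m} {suc n} _ _ = cong suc

  too-many : ∀ {m} (f : Fin m → ℕ) → Injective _≡_ _≡_ f → (∀ i → 1 ℕ.≤ f i × f i ℕ.≤ X) → ¬ X ℕ.< m
  too-many {m} f f-inj f∈ X<m =
    let i , j , i<j , eq = Fin.pigeonhole X<m (λ i → Fin.fromℕ< (small i)) in
    Fin.<⇒≢ i<j (f-inj (pred-inj (proj₁ (f∈ i)) (proj₁ (f∈ j))
      (trans (sym (Fin.toℕ-fromℕ< (small i))) (trans (cong toℕ eq) (Fin.toℕ-fromℕ< (small j))))))
    where
    small : ∀ i → ℕ.pred (f i) ℕ.< X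
    small i with f i | f∈ i
    ... | suc n | _ , n<X = n<X

infixl 7 _÷ℕ_

_÷ℕ_ : ℝ → (n : ℕ) → .{{NonZero n}} → ℝ
x ÷ℕ n = record
  { cut       = λ p → p ℚ.* fromℕ n ∈ cut x
  ; inhabited = let p , p∈ = x.inhabited ; t , eq = ÷-exists p 0<n in t , subst (_∈ cut x) (sym eq) p∈
  ; proper    = let p , p∉ = x.proper ; t , eq = ÷-exists p 0<n in t , subst (_∉ cut x) (sym eq) p∉
  ; lower     = λ p<q → x.lower (*-monoˡ-< 0<n p<q)
  ; open′     = λ pn∈ → let q , pn<q , q∈ = x.open′ pn∈ ; t , p<t , tn<q = ÷-between 0<n pn<q
                        in t , p<t , x.lower tn<q q∈
  }
  where
  module x = ℝ x
  0<n = fromℕ-pos n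

-- liminf x n = sup_N inf_{n ≥ N} x n, for a sequence indexed by the positive
-- integers and lying between two rationals.

liminf : (x : (n : ℕ) → .{{NonZero n}} → ℝ) (a b : ℚ) →
         (∀ n .{{_ : NonZero n}} → a ∈ cut (x n)) →
         (∀ n .{{_ : NonZero n}} → b ∉ cut (x n)) → ℝ
liminf x a b a∈ b∉ = record
  { cut       = lim-cut
  ; inhabited = a ℚ.- 1ℚ , a , subst (a ℚ.- 1ℚ ℚ.<_) (ℚ.+-identityʳ a) (ℚ.+-monoʳ-< a -1<0) ,
                0 , λ n _ → a∈ n
  ; proper    = b , λ (q , b<q , N , q∈) →
                b∉ (suc N) (ℝ.lower (x (suc N)) b<q (q∈ (suc N) (ℕ.n≤1+n N)))
  ; lower     = λ p<p′ (q , p′<q , N , q∈) → q , (p<p′ <⟫ p′<q) , N , q∈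
  ; open′     = λ (q , p<q , N , q∈) →
                let p′ , p<p′ , p′<q = ℚ.<-dense p<q in p′ , p<p′ , q , p′<q , N , q∈
  }
  where
  lim-cut : Pred ℚ 0ℓ
  lim-cut p = Σ[ q ∈ ℚ ] p ℚ.< q × (Σ[ N ∈ ℕ ] (∀ n .{{_ : NonZero n}} → N ℕ.≤ n → q ∈ cut (x n)))

lowerDensity : Pred ℕ 0ℓ → ℝ
lowerDensity A = liminf (λ X → ∣ A ∩[1, X ]∣ ÷ℕ X) (ℚ.- 1ℚ) 1ℚ
  (λ X → 0 , ((λ ()) , (λ { {()} }) , λ ()) ,
    subst (ℚ.- 1ℚ ℚ.* fromℕ X ℚ.<_) (ℚ.*-zeroˡ (fromℕ X)) (*-monoˡ-< (fromℕ-pos X) -1<0))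
  (λ X → subst (_∉ cut ∣ A ∩[1, X ]∣) (sym (ℚ.*-identityˡ (fromℕ X)))
    (proj₂ (ℝ.proper ∣ A ∩[1, X ]∣)))

module Submission where

open import Algebra.Bundles using (CommutativeRing)
open import Data.Fin using (Fin; zero; suc; toℕ)
import Data.Fin.Properties as Fin
import Data.Integer as ℤ
import Data.Integer.Properties as ℤ
open import Data.List hiding (sum; product)
open import Data.List.Membership.Propositional using (_∈_)
open import Data.List.Membership.Propositional.Properties
import Data.List.Membership.Setoid.Properties as Membership
open import Data.List.Properties using (filter-accept; filter-reject; length-map; length-++; length-upTo; map-++)
open import Data.List.Relation.Unary.All as All using (All; []; _∷_)
import Data.List.Relation.Unary.All.Properties as All
open import Data.List.Relation.Unary.AllPairs using ([]; _∷_)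
open import Data.List.Relation.Unary.Any using (here; there; index)
open import Data.List.Relation.Unary.Unique.DecPropositional.Properties using (deduplicate-!)
open import Data.List.Relation.Unary.Unique.Propositional using (Unique)
import Data.List.Relation.Unary.Unique.Propositional.Properties as Unique
open import Data.Nat as ℕ using (ℕ; NonZero; zero; suc; z≤n; s≤s)
open import Data.Nat.ListAction using (sum; product)
open import Data.Nat.ListAction.Properties using (sum-++; ∈⇒≤product)
import Data.Nat.Properties as ℕ
open import Data.Nat.Properties using (<⇒≤)
open import Data.Nat.Tactic.RingSolver using (solve-∀)
open import Data.Product using (Σ-syntax; ∃; ∃₂; _×_; _,_; proj₁; proj₂)
open import Data.Rational as ℚ using (ℚ; mkℚ; 0ℚ; 1ℚ; ½)
import Data.Rational.Properties as ℚ
import Data.Rational.Unnormalised as ℚᵘ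
open import Data.Sum using (inj₁; inj₂)
open import Function.Base using (_∘_; case_of_)
open import Function.Definitions using (Injective)
open import Level using (0ℓ)
open import Relation.Binary.PropositionalEquality using (_≡_; refl; sym; trans; cong; cong₂; subst; subst₂; setoid; module ≡-Reasoning)
open import Relation.Nullary
open import Relation.Unary using (Pred; _∉_)

{-
Suppose that |A ∩ [1, 4^j]| is smaller than a small constant times 2^j / j^α in
a long range of scales j, and let n = 4^m with m large.  In a product x ≤ n of
k elements of A, let b be the largest factor and P the product of the others.
Then n / P ≥ n^(1/k), so log (n / P) is comparable to log n and b is one of at
most δ (n / P)^(1/2) (log n)^(-α) elements of A.  Summing over P, there are at most
  δ n^(1/2) (log n)^(-α) (Σ a^(-1/2))^(k-1),   a ∈ A ∩ [1, n],
such products.  As α < 1, dyadic summation gives Σ a^(-1/2) ≪ δ (log n)^(1-α), where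
the contribution of the finitely many uncontrolled small scales is absorbed when
n is large.  Hence the numbers of k-fold and of l-fold products up to n
multiply to ≪ δ^(k+l) n (log n)^(k+l-2-(k+l)α) = δ^(k+l) n, which for small δ
contradicts the density of A^k + A^l at n.

Fractional powers are avoided by taking m = R^(k+l), so that m^α = R^(k+l-2).
-}

module Counting where

  open import Data.Nat hiding (ℕ; NonZero; zero; suc; z≤n; s≤s)
  open import Data.Nat.Properties hiding (_≟_; <⇒≤)

  -- Powers and base-4 levels.

  n<2^n : ∀ n → n < 2 ^ n
  n<2^n zero    = s≤s z≤n
  n<2^n (suc n) = +-mono-≤ (m^n>0 2 n) (≤-trans (n<2^n n) (m≤m+n _ 0))

  ^-distrib-* : ∀ m n o → (m * n) ^ o ≡ m ^ o * n ^ o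
  ^-distrib-* m n zero    = refl
  ^-distrib-* m n (suc o) rewrite ^-distrib-* m n o = shuffle m n (m ^ o) (n ^ o)
    where
    shuffle : ∀ a b c d → a * b * (c * d) ≡ a * c * (b * d)
    shuffle = solve-∀

  ^-cancelˡ-≤ : ∀ n .{{_ : NonZero n}} {a b} → a ^ n ≤ b ^ n → a ≤ b
  ^-cancelˡ-≤ n aⁿ≤bⁿ = ≮⇒≥ λ b<a → <⇒≱ (^-monoˡ-< n b<a) aⁿ≤bⁿ

  ^-cancelʳ-≤ : ∀ a {m n} → 1 < a → a ^ m ≤ a ^ n → m ≤ n
  ^-cancelʳ-≤ a 1<a aᵐ≤aⁿ = ≮⇒≥ λ n<m → <⇒≱ (^-monoʳ-< a 1<a n<m) aᵐ≤aⁿ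

  -- level a = ⌊log₄ a⌋ for a ≥ 1, and level 0 = 0.
  level : ℕ → ℕ
  level zero    = 0
  level (suc a) with 4 ^ suc (level a) ≤? suc a
  ... | yes _ = suc (level a)
  ... | no  _ = level a

  4^level≤ : ∀ a .{{_ : NonZero a}} → 4 ^ level a ≤ a
  4^level≤ (suc zero)      = ≤-refl
  4^level≤ (suc a@(suc _)) = step a (4^level≤ a)
    where
    step : ∀ a → 4 ^ level a ≤ a → 4 ^ level (suc a) ≤ suc a
    step a ≤a with 4 ^ suc (level a) ≤? suc a
    ... | yes ≤1+a = ≤1+a
    ... | no  _    = m≤n⇒m≤1+n ≤a

  <4^level : ∀ a → a < 4 ^ suc (level a)
  <4^level zero    = s≤s z≤n
  <4^level (suc a) with 4 ^ suc (level a) ≤? suc a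
  ... | yes _  = ≤-<-trans (<4^level a) (^-monoʳ-< 4 (s≤s (s≤s z≤n)) (n<1+n (suc (level a))))
  ... | no ≰a  = ≰⇒> ≰a

  level≤ : ∀ {a m} .{{_ : NonZero a}} → a ≤ 4 ^ m → level a ≤ m
  level≤ {a} a≤ = ^-cancelʳ-≤ 4 (s≤s (s≤s z≤n)) (≤-trans (4^level≤ a) a≤)

  -- Counting in finite lists and dyadic sums.

  count : List ℕ → ℕ → ℕ
  count F x = length (filter (_≤? x) F)

  injective⇒≤-length : ∀ {A : Set} {m} (f : Fin m → A) → Injective _≡_ _≡_ f →
    (xs : List A) → (∀ i → f i ∈ xs) → m ≤ length xs
  injective⇒≤-length f f-inj xs f∈ = Fin.injective⇒≤ {f = λ i → index (f∈ i)} λ {i} {j} eq →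
    f-inj (Membership.index-injective (setoid _) (f∈ i) (f∈ j) eq)

  lookup-injective : ∀ {A : Set} {xs : List A} → Unique xs → Injective _≡_ _≡_ (lookup xs)
  lookup-injective (_ ∷ _) {zero}  {zero}  _  = refl
  lookup-injective (x∉ ∷ _) {zero}  {suc j} eq = contradiction eq (All.lookup x∉ (∈-lookup j))
  lookup-injective (x∉ ∷ _) {suc i} {zero}  eq = contradiction (sym eq) (All.lookup x∉ (∈-lookup i))
  lookup-injective (_ ∷ u) {suc i} {suc j} eq = cong suc (lookup-injective u eq)

  count≤ : ∀ {F} → Unique F → ∀ x → count F x ≤ suc x
  count≤ {F} u x = subst (count F x ≤_) (length-upTo (suc x))
    (injective⇒≤-length _ (lookup-injective (Unique.filter⁺ (_≤? x) u)) (upTo (suc x))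
      λ i → ∈-upTo⁺ (s≤s (proj₂ (∈-filter⁻ (_≤? x) {xs = F} (∈-lookup i)))))

  count-∷ : ∀ a F x → count F x ≤ count (a ∷ F) x
  count-∷ a F x with a ≤? x
  ... | yes a≤x rewrite filter-accept (_≤? x) {xs = F} a≤x = n≤1+n _
  ... | no  a≰x rewrite filter-reject (_≤? x) {xs = F} a≰x = ≤-refl

  count-∷-≤ : ∀ {a} F {x} → a ≤ x → suc (count F x) ≤ count (a ∷ F) x
  count-∷-≤ F {x} a≤x rewrite filter-accept (_≤? x) {xs = F} a≤x = ≤-refl

  ∑< : ℕ → (ℕ → ℕ) → ℕ
  ∑< x y = sum (applyDownFrom y x)

  -- The block has `x′ ∸ x` terms, counted crudely as `x′`; this is harmless for blocks whose
  -- endpoints grow geometrically. The factor `z` clears the denominator of the termwise bound.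
  ∑-block : ∀ (y : ℕ → ℕ) z b {x x′} → x ≤ x′ → (∀ {j} → x ≤ j → j < x′ → z * y j ≤ b) →
    z * ∑< x′ y ≤ z * ∑< x y + x′ * b
  ∑-block y z b {x′ = zero}  z≤n _  = m≤m+n _ 0
  ∑-block y z b {x} {suc x′} x≤x′ zy≤b with m≤n⇒m<n∨m≡n x≤x′
  ... | inj₂ refl = m≤m+n _ _
  ... | inj₁ (s≤s x≤) = begin
    z * (y x′ + ∑< x′ y)               ≡⟨ *-distribˡ-+ z (y x′) _ ⟩
    z * y x′ + z * ∑< x′ y             ≤⟨ +-mono-≤ (zy≤b x≤ ≤-refl)
                                            (∑-block y z b x≤ λ x≤j j<x′ → zy≤b x≤j (m<n⇒m<1+n j<x′)) ⟩
    b + (z * ∑< x y + x′ * b)          ≡⟨ shuffle b (z * ∑< x y) (x′ * b) ⟩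
    z * ∑< x y + suc x′ * b            ∎
    where
    open ≤-Reasoning
    shuffle : ∀ p q r → p + (q + r) ≡ q + (p + r)
    shuffle = solve-∀

  ∑-mono : ∀ (y y′ : ℕ → ℕ) → (∀ j → y j ≤ y′ j) → ∀ x → ∑< x y ≤ ∑< x y′
  ∑-mono y y′ y≤y′ zero    = z≤n
  ∑-mono y y′ y≤y′ (suc x) = +-mono-≤ (y≤y′ x) (∑-mono y y′ y≤y′ x)

  ∑-mono-at : ∀ (y y′ : ℕ → ℕ) c {i x} → (∀ j → y j ≤ y′ j) → i < x → c + y i ≤ y′ i →
    c + ∑< x y ≤ ∑< x y′
  ∑-mono-at y y′ c {i} {suc x} y≤y′ (s≤s i≤x) c+y≤y′ with m≤n⇒m<n∨m≡n i≤x
  ... | inj₂ refl = begin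
    c + (y x + ∑< x y)    ≡⟨ +-assoc c _ _ ⟨
    c + y x + ∑< x y      ≤⟨ +-mono-≤ c+y≤y′ (∑-mono y y′ y≤y′ x) ⟩
    y′ x + ∑< x y′        ∎
    where open ≤-Reasoning
  ... | inj₁ i<x = begin
    c + (y x + ∑< x y)    ≡⟨ shuffle c (y x) _ ⟩
    y x + (c + ∑< x y)    ≤⟨ +-mono-≤ (y≤y′ x) (∑-mono-at y y′ c y≤y′ i<x c+y≤y′) ⟩
    y′ x + ∑< x y′        ∎
    where
    open ≤-Reasoning
    shuffle : ∀ p q r → p + (q + r) ≡ q + (p + r)
    shuffle = solve-∀

  length-cartesianProductWith : ∀ {A B C : Set} (f : A → B → C) xs ys →
    length (cartesianProductWith f xs ys) ≡ length xs * length ys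
  length-cartesianProductWith f []       ys = refl
  length-cartesianProductWith f (x ∷ xs) ys = trans (length-++ (map (f x) ys))
    (cong₂ _+_ (length-map (f x) ys) (length-cartesianProductWith f xs ys))

  -- Up to a factor 2 this is 2^Ω / √a; the common numerator keeps the weights integral.
  weight : ℕ → ℕ → ℕ
  weight Ω a = 2 ^ (Ω ∸ level a)

  -- Since `a < 4 ^ suc (level a)`, the element `a` is counted at `j = suc (level a)`, where the
  -- coefficient is half its weight; hence the factor 2. The hypothesis places this `j` below `Ω`.
  ∑weight≤ : ∀ Ω F → All (λ a → suc (level a) < Ω) F →
    sum (map (weight Ω) F) ≤ 2 * ∑< Ω (λ j → count F (4 ^ j) * 2 ^ (Ω ∸ j))
  ∑weight≤ Ω []      []           = z≤n
  ∑weight≤ Ω (a ∷ F) (l<Ω ∷ F<Ω) = begin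
    weight Ω a + sum (map (weight Ω) F)   ≡⟨ cong (λ n → 2 ^ n + sum (map (weight Ω) F)) (+-∸-assoc 1 (<⇒≤ l<Ω)) ⟩
    2 * c + sum (map (weight Ω) F)        ≤⟨ +-monoʳ-≤ (2 * c) (∑weight≤ Ω F F<Ω) ⟩
    2 * c + 2 * ∑< Ω (y F)                ≡⟨ *-distribˡ-+ 2 c _ ⟨
    2 * (c + ∑< Ω (y F))                  ≤⟨ *-monoʳ-≤ 2 (∑-mono-at (y F) (y (a ∷ F)) c
                                               (λ j → *-monoˡ-≤ (2 ^ (Ω ∸ j)) (count-∷ a F (4 ^ j))) l<Ω
                                               (*-monoˡ-≤ c (count-∷-≤ F (<⇒≤ (<4^level a))))) ⟩
    2 * ∑< Ω (y (a ∷ F))                  ∎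
    where
    open ≤-Reasoning
    y : List ℕ → ℕ → ℕ
    y F j = count F (4 ^ j) * 2 ^ (Ω ∸ j)
    c = 2 ^ (Ω ∸ suc (level a))

  -- Tuples of factors, pivots and bounded products.

  tuples : List ℕ → ℕ → List (List ℕ)
  tuples F zero    = [] ∷ []
  tuples F (suc n) = cartesianProductWith _∷_ F (tuples F n)

  levels : List ℕ → ℕ
  levels ys = sum (map level ys)

  ∑tuples : ∀ (h : ℕ → ℕ) F n → sum (map (product ∘ map h) (tuples F n)) ≡ sum (map h F) ^ n
  ∑tuples h F zero    = refl
  ∑tuples h F (suc n) = trans (go F (tuples F n)) (cong (sum (map h F) *_) (∑tuples h F n))
    where
    ∑cons : ∀ a yss → sum (map (product ∘ map h) (map (a ∷_) yss)) ≡ h a * sum (map (product ∘ map h) yss)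
    ∑cons a []         = sym (*-zeroʳ (h a))
    ∑cons a (ys ∷ yss) = trans (cong (_ +_) (∑cons a yss)) (sym (*-distribˡ-+ (h a) (product (map h ys)) _))

    go : ∀ G yss → sum (map (product ∘ map h) (cartesianProductWith _∷_ G yss)) ≡
      sum (map h G) * sum (map (product ∘ map h) yss)
    go []      yss = refl
    go (a ∷ G) yss = begin
      sum (map _ (map (a ∷_) yss ++ cartesianProductWith _∷_ G yss))
        ≡⟨ cong sum (map-++ _ (map (a ∷_) yss) _) ⟩
      sum (map _ (map (a ∷_) yss) ++ map _ (cartesianProductWith _∷_ G yss))
        ≡⟨ sum-++ (map _ (map (a ∷_) yss)) _ ⟩
      sum (map _ (map (a ∷_) yss)) + sum (map _ (cartesianProductWith _∷_ G yss))
        ≡⟨ cong₂ _+_ (∑cons a yss) (go G yss) ⟩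
      h a * S + sum (map h G) * S
        ≡⟨ *-distribʳ-+ S (h a) _ ⟨
      (h a + sum (map h G)) * S ∎
      where
      open ≡-Reasoning
      S = sum (map (product ∘ map h) yss)

  -- Per entry the exponents `Ω ∸ level a` and `level a` add up to `Ω`. Thus a product of weights
  -- stands for the inverse of `2 ^ levels ys`, up to a fixed power of two.
  weight-levels : ∀ Ω F → All (λ a → level a ≤ Ω) F → ∀ n {ys} → ys ∈ tuples F n →
    product (map (weight Ω) ys) * 2 ^ levels ys ≡ (2 ^ Ω) ^ n
  weight-levels Ω F F≤ zero    (here refl) = refl
  weight-levels Ω F F≤ (suc n) ys∈
    with a , ys , a∈ , ys∈′ , refl ← ∈-cartesianProductWith⁻ _∷_ F (tuples F n) ys∈ = begin
    weight Ω a * W * 2 ^ (level a + levels ys)           ≡⟨ cong (weight Ω a * W *_) (^-distribˡ-+-* 2 (level a) _) ⟩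
    weight Ω a * W * (2 ^ level a * 2 ^ levels ys)       ≡⟨ shuffle (weight Ω a) W (2 ^ level a) _ ⟩
    weight Ω a * 2 ^ level a * (W * 2 ^ levels ys)       ≡⟨ cong₂ _*_ (^-distribˡ-+-* 2 (Ω ∸ level a) _) (sym (weight-levels Ω F F≤ n ys∈′)) ⟨
    2 ^ (Ω ∸ level a + level a) * (2 ^ Ω) ^ n            ≡⟨ cong (λ i → 2 ^ i * (2 ^ Ω) ^ n) (m∸n+n≡m (All.lookup F≤ a∈)) ⟩
    (2 ^ Ω) ^ suc n                                      ∎
    where
    open ≡-Reasoning
    W = product (map (weight Ω) ys)
    shuffle : ∀ a b c d → a * b * (c * d) ≡ a * c * (b * d)
    shuffle = solve-∀

  4^levels≤ : ∀ {F} → All NonZero F → ∀ n {ys} → ys ∈ tuples F n → 4 ^ levels ys ≤ product ys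
  4^levels≤ F≢0 zero (here refl) = ≤-refl
  4^levels≤ {F} F≢0 (suc n) ys∈
    with a , ys , a∈ , ys∈′ , refl ← ∈-cartesianProductWith⁻ _∷_ F (tuples F n) ys∈ = begin
    4 ^ (level a + levels ys)       ≡⟨ ^-distribˡ-+-* 4 (level a) _ ⟩
    4 ^ level a * 4 ^ levels ys     ≤⟨ *-mono-≤ (4^level≤ a {{All.lookup F≢0 a∈}}) (4^levels≤ F≢0 n ys∈′) ⟩
    a * product ys                  ∎
    where open ≤-Reasoning

  -- The pivot b is a factor of maximal level.
  pivot : ∀ {F a} xs → a ∈ F → All (_∈ F) xs → ∃₂ λ b ys →
    b ∈ F × ys ∈ tuples F (length xs) × b * product ys ≡ a * product xs × levels ys ≤ length xs * level b
  pivot []               a∈ []          = _ , [] , a∈ , here refl , refl , z≤n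
  pivot {F} {a} (x ∷ xs) a∈ (x∈ ∷ xs∈)
    with b , ys , b∈ , ys∈ , eq , ≤b ← pivot xs x∈ xs∈ with level a ≤? level b
  ... | yes a≤b = b , a ∷ ys , b∈ , ∈-cartesianProductWith⁺ _∷_ a∈ ys∈ ,
          trans (shuffle b a (product ys)) (cong (a *_) eq) , +-mono-≤ a≤b ≤b
    where
    shuffle : ∀ b a c → b * (a * c) ≡ a * (b * c)
    shuffle = solve-∀
  ... | no  a≰b = a , b ∷ ys , a∈ , ∈-cartesianProductWith⁺ _∷_ b∈ ys∈ , cong (a *_) eq ,
          ≤-trans (+-monoʳ-≤ (level b) ≤b) (*-monoʳ-≤ (suc (length xs)) (≰⇒≥ a≰b))

  -- The products b * Π ys ≤ 4^m with pivot b.  The test on ys expresses that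
  -- 4^(m ∸ levels ys), which bounds b, is at least the (n+1)-st root of 4^m.
  pivotProducts : List ℕ → ℕ → ℕ → List ℕ → List ℕ
  pivotProducts F m n ys with m ≤? suc n * (m ∸ levels ys)
  ... | yes _ = map (_* product ys) (filter (_≤? 4 ^ (m ∸ levels ys)) F)
  ... | no  _ = []

  products : List ℕ → ℕ → ℕ → List ℕ
  products F m n = concatMap (pivotProducts F m n) (tuples F n)

  -- Take the pivot `b`, the other factors `ys` and `s = levels ys`. Then `4 ^ s ≤ product ys` gives
  -- `b ≤ 4 ^ (m ∸ s)`, and `s ≤ n * level b ≤ n * (m ∸ s)` gives the test `m ≤ suc n * (m ∸ s)`.
  ∈-products : ∀ {F m a} → All NonZero F → ∀ xs → a ∈ F → All (_∈ F) xs → a * product xs ≤ 4 ^ m →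
    a * product xs ∈ products F m (length xs)
  ∈-products {F} {m} F≢0 xs a∈ xs∈ ≤4^m
    with b , ys , b∈ , ys∈ , eq , ≤b ← pivot xs a∈ xs∈ rewrite sym eq =
    ∈-concat⁺′ product∈pivotProducts (∈-map⁺ (pivotProducts F m n) ys∈)
    where
    open ≤-Reasoning
    n = length xs
    s = levels ys

    b+s≤m : level b + s ≤ m
    b+s≤m = ^-cancelʳ-≤ 4 (s≤s (s≤s z≤n)) (begin
      4 ^ (level b + s)       ≡⟨ ^-distribˡ-+-* 4 (level b) s ⟩
      4 ^ level b * 4 ^ s     ≤⟨ *-mono-≤ (4^level≤ b {{All.lookup F≢0 b∈}}) (4^levels≤ F≢0 n ys∈) ⟩
      b * product ys          ≤⟨ ≤4^m ⟩
      4 ^ m                   ∎)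

    s≤m = m+n≤o⇒n≤o (level b) b+s≤m

    b≤ : b ≤ 4 ^ (m ∸ s)
    b≤ = *-cancelʳ-≤ b _ (4 ^ s) {{m^n≢0 4 s}} (begin
      b * 4 ^ s               ≤⟨ *-monoʳ-≤ b (4^levels≤ F≢0 n ys∈) ⟩
      b * product ys          ≤⟨ ≤4^m ⟩
      4 ^ m                   ≡⟨ cong (4 ^_) (m∸n+n≡m s≤m) ⟨
      4 ^ (m ∸ s + s)         ≡⟨ ^-distribˡ-+-* 4 (m ∸ s) s ⟩
      4 ^ (m ∸ s) * 4 ^ s     ∎)

    m≤ : m ≤ suc n * (m ∸ s)
    m≤ = begin
      m                       ≡⟨ m∸n+n≡m s≤m ⟨
      m ∸ s + s               ≤⟨ +-monoʳ-≤ (m ∸ s) (≤-trans ≤b (*-monoʳ-≤ n (m+n≤o⇒m≤o∸n (level b) b+s≤m))) ⟩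
      suc n * (m ∸ s)         ∎

    product∈pivotProducts : b * product ys ∈ pivotProducts F m n ys
    product∈pivotProducts with m ≤? suc n * (m ∸ s)
    ... | yes _ = ∈-map⁺ (_* product ys) (∈-filter⁺ (_≤? 4 ^ (m ∸ s)) b∈ b≤)
    ... | no  ≰ = contradiction m≤ ≰

  length-concatMap-≤ : ∀ {A B : Set} (f : A → List B) (w : A → ℕ) c d yss →
    (∀ {ys} → ys ∈ yss → c * length (f ys) ≤ d * w ys) →
    c * length (concatMap f yss) ≤ d * sum (map w yss)
  length-concatMap-≤ f w c d []         _  = ≤-reflexive (trans (*-zeroʳ c) (sym (*-zeroʳ d)))
  length-concatMap-≤ f w c d (ys ∷ yss) f≤ = begin
    c * length (f ys ++ concatMap f yss)               ≡⟨ cong (c *_) (length-++ (f ys)) ⟩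
    c * (length (f ys) + length (concatMap f yss))     ≡⟨ *-distribˡ-+ c _ _ ⟩
    c * length (f ys) + c * length (concatMap f yss)   ≤⟨ +-mono-≤ (f≤ (here refl)) (length-concatMap-≤ f w c d yss (f≤ ∘ there)) ⟩
    d * w ys + d * sum (map w yss)                     ≡⟨ *-distribˡ-+ d _ _ ⟨
    d * (w ys + sum (map w yss))                       ∎
    where open ≤-Reasoning

  -- Counting the products of a sparse list.

  -- The constant of `H≤`: in the parentheses, 1 is the share of the initial scales and
  -- `4 * 2 ^ (2 + e)` that of the controlled blocks; the outer 2 comes from `∑weight≤`.
  B : ℕ → ℕ
  B e = 2 * (1 + 4 * 2 ^ (2 + e))

  -- Here `K` is k + l and `e` is k + l - 2, so α = e / K: a scale `j` near `(2 ^ c) ^ K` has j^α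
  -- near `(2 ^ c) ^ e`. Scales are cut into blocks at these K-th powers; `m` and `Ω` are
  -- consecutive endpoints.
  module Sparse (e D c₀ t : ℕ) where

    K m Ω : ℕ
    K = 2 + e
    m = (2 ^ suc t) ^ K
    Ω = (2 ^ suc (suc t)) ^ K

    -- Bounds the contribution of the scales j < (2 ^ c₀) ^ K, where no
    -- hypothesis is available, to D * Σ a^(-1/2).
    initial : ℕ
    initial = D * ((2 ^ c₀) ^ K * 4 ^ ((2 ^ c₀) ^ K))

    -- The field `sparse` expresses failure of density at scale `j`, with j^α replaced by its lower
    -- bound `(2 ^ c) ^ e`.
    record SparseList (F : List ℕ) : Set where
      field
        sparse   : ∀ c → c₀ ≤ c → ∀ {j} → (2 ^ c) ^ K ≤ j → j < Ω → D * (2 ^ c) ^ e * count F (4 ^ j) ≤ 2 ^ j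
        unique   : Unique F
        F≢0      : All NonZero F
        F≤       : All (_≤ 4 ^ m) F
        c₀≤t     : c₀ ≤ t
        initial≤ : initial ≤ 2 ^ suc t * 2 ^ suc t
        D≢0      : NonZero D

    module _ {F} (sparseList : SparseList F) where
      open SparseList sparseList
      open ≤-Reasoning
      instance _ = D≢0

      R r H : ℕ
      R = 2 ^ suc t
      r = 2 ^ t
      H = sum (map (weight Ω) F)

      2^^≢0 : ∀ n o → NonZero ((2 ^ n) ^ o)
      2^^≢0 n o = m^n≢0 (2 ^ n) o {{m^n≢0 2 n}}

      2^sucᴷ : ∀ c → (2 ^ suc c) ^ K ≡ 2 ^ K * (2 ^ c) ^ K
      2^sucᴷ c = ^-distrib-* 2 (2 ^ c) K

      Ω≡ : Ω ≡ 2 ^ K * m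
      Ω≡ = 2^sucᴷ (suc t)

      m>0 : 0 < m
      m>0 = >-nonZero⁻¹ m {{2^^≢0 (suc t) K}}

      1+m<Ω : suc m < Ω
      1+m<Ω = begin
        suc (suc m)       ≤⟨ +-mono-≤ m>0 (+-mono-≤ m>0 (m≤m+n m _)) ⟩
        4 * m             ≤⟨ *-monoˡ-≤ m (^-monoʳ-≤ 2 {2} {K} (s≤s (s≤s z≤n))) ⟩
        2 ^ K * m         ≡⟨ Ω≡ ⟨
        Ω                 ∎

      V : ℕ → ℕ
      V x = ∑< x λ j → count F (4 ^ j) * 2 ^ (Ω ∸ j)

      -- Without sparsity, the trivial count of the integers up to `4 ^ j` is used.
      V-initial : D * V ((2 ^ c₀) ^ K) ≤ initial * 2 ^ Ω
      V-initial = begin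
        D * V x                        ≤⟨ ∑-block y D b z≤n y≤ ⟩
        D * 0 + x * b                  ≡⟨ shuffle D x (4 ^ x) (2 ^ Ω) ⟩
        initial * 2 ^ Ω                      ∎
        where
        x = (2 ^ c₀) ^ K
        b = D * (4 ^ x * 2 ^ Ω)
        y : ℕ → ℕ
        y j = count F (4 ^ j) * 2 ^ (Ω ∸ j)
        shuffle : ∀ d x p q → d * 0 + x * (d * (p * q)) ≡ d * (x * p) * q
        shuffle = solve-∀
        y≤ : ∀ {j} → 0 ≤ j → j < x → D * y j ≤ b
        y≤ {j} _ j<x = *-monoʳ-≤ D (*-mono-≤
          (begin
            count F (4 ^ j)         ≤⟨ count≤ unique (4 ^ j) ⟩
            suc (4 ^ j)             ≤⟨ +-monoˡ-≤ (4 ^ j) (m^n>0 4 j) ⟩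
            4 ^ j + 4 ^ j           ≤⟨ +-monoʳ-≤ (4 ^ j) (m≤m+n (4 ^ j) _) ⟩
            4 ^ suc j               ≤⟨ ^-monoʳ-≤ 4 j<x ⟩
            4 ^ x                   ∎)
          (^-monoʳ-≤ 2 (m∸n≤m Ω j)))

      -- A block (2 ^ c) ^ K ≤ j < (2 ^ suc c) ^ K contributes at most its length
      -- times 1 / (2 ^ c) ^ e, that is 2 ^ K * 4 ^ c as K = 2 + e.
      V-step : ∀ c → c₀ ≤ c → c ≤ suc t →
        D * V ((2 ^ suc c) ^ K) ≤ D * V ((2 ^ c) ^ K) + 2 ^ c * 2 ^ c * (2 ^ K * 2 ^ Ω)
      V-step c c₀≤c c≤ = *-cancelˡ-≤ z {{2^^≢0 c e}} (begin
        z * (D * V x′)                    ≡⟨ *-assoc z D _ ⟨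
        z * D * V x′                      ≤⟨ ∑-block y (z * D) (2 ^ Ω) (^-monoˡ-≤ K (^-monoʳ-≤ 2 (n≤1+n c))) y≤ ⟩
        z * D * V x + x′ * 2 ^ Ω          ≡⟨ cong₂ _+_ (*-assoc z D _) (cong (_* 2 ^ Ω) (2^sucᴷ c)) ⟩
        z * (D * V x) + 2 ^ K * (q * (q * z)) * 2 ^ Ω
                                          ≡⟨ shuffle z (D * V x) q (2 ^ K) (2 ^ Ω) ⟩
        z * (D * V x + q * q * (2 ^ K * 2 ^ Ω)) ∎)
        where
        q = 2 ^ c
        z = q ^ e
        x = q ^ K
        x′ = (2 ^ suc c) ^ K
        y : ℕ → ℕ
        y j = count F (4 ^ j) * 2 ^ (Ω ∸ j)
        shuffle : ∀ z v q k p → z * v + k * (q * (q * z)) * p ≡ z * (v + q * q * (k * p))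
        shuffle = solve-∀
        y≤ : ∀ {j} → x ≤ j → j < x′ → z * D * y j ≤ 2 ^ Ω
        y≤ {j} x≤j j<x′ = begin
          z * D * (count F (4 ^ j) * 2 ^ (Ω ∸ j))   ≡⟨ *-assoc (z * D) _ _ ⟨
          z * D * count F (4 ^ j) * 2 ^ (Ω ∸ j)     ≡⟨ cong (λ i → i * count F (4 ^ j) * 2 ^ (Ω ∸ j)) (*-comm z D) ⟩
          D * z * count F (4 ^ j) * 2 ^ (Ω ∸ j)     ≤⟨ *-monoˡ-≤ (2 ^ (Ω ∸ j)) (sparse c c₀≤c x≤j j<Ω) ⟩
          2 ^ j * 2 ^ (Ω ∸ j)                       ≡⟨ ^-distribˡ-+-* 2 j _ ⟨
          2 ^ (j + (Ω ∸ j))                         ≡⟨ cong (2 ^_) (m+[n∸m]≡n (<⇒≤ j<Ω)) ⟩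
          2 ^ Ω                                     ∎
          where
          j<Ω : j < Ω
          j<Ω = <-≤-trans j<x′ (^-monoˡ-≤ K (^-monoʳ-≤ 2 (s≤s c≤)))

      -- Block bounds grow by a factor 4, so the next term dominates all earlier ones:
      -- `2 * q * (2 * q) * G` has room for `q * q * G` twice.
      V≤ : ∀ d → c₀ + d ≤ suc (suc t) →
        D * V ((2 ^ (c₀ + d)) ^ K) ≤ initial * 2 ^ Ω + 2 ^ (c₀ + d) * 2 ^ (c₀ + d) * (2 ^ K * 2 ^ Ω)
      V≤ zero    _  rewrite +-identityʳ c₀ = ≤-trans V-initial (m≤m+n _ _)
      V≤ (suc d) ≤t rewrite +-suc c₀ d = begin
        D * V ((2 ^ suc c) ^ K)                   ≤⟨ V-step c (m≤m+n c₀ d) (s≤s⁻¹ ≤t) ⟩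
        D * V ((2 ^ c) ^ K) + q * q * G           ≤⟨ +-monoˡ-≤ (q * q * G) (V≤ d (<⇒≤ ≤t)) ⟩
        initial * 2 ^ Ω + q * q * G + q * q * G         ≤⟨ m≤m+n _ (2 * (q * q * G)) ⟩
        initial * 2 ^ Ω + q * q * G + q * q * G + 2 * (q * q * G)
                                                  ≡⟨ shuffle (initial * 2 ^ Ω) q G ⟩
        initial * 2 ^ Ω + 2 * q * (2 * q) * G           ∎
        where
        c = c₀ + d
        q = 2 ^ c
        G = 2 ^ K * 2 ^ Ω
        shuffle : ∀ j q g → j + q * q * g + q * q * g + 2 * (q * q * g) ≡ j + 2 * q * (2 * q) * g
        shuffle = solve-∀

      -- This is Σ a^(-1/2) ≪ (log n)^(1-α) / D, since 1 - α = 2 / K and `m` is the K-th power of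
      -- `R`.
      H≤ : D * H ≤ B e * (R * R) * 2 ^ Ω
      H≤ = begin
        D * H                                                ≤⟨ *-monoʳ-≤ D (∑weight≤ Ω F levels<Ω) ⟩
        D * (2 * V Ω)                                        ≡⟨ swap D (V Ω) ⟩
        2 * (D * V Ω)                                        ≤⟨ *-monoʳ-≤ 2 VΩ≤ ⟩
        2 * (initial * 2 ^ Ω + 2 * R * (2 * R) * (2 ^ K * 2 ^ Ω))  ≤⟨ *-monoʳ-≤ 2 (+-monoˡ-≤ _ (*-monoˡ-≤ (2 ^ Ω) initial≤)) ⟩
        2 * (R * R * 2 ^ Ω + 2 * R * (2 * R) * (2 ^ K * 2 ^ Ω)) ≡⟨ shuffle R (2 ^ K) (2 ^ Ω) ⟩
        B e * (R * R) * 2 ^ Ω                                ∎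
        where
        swap : ∀ d v → d * (2 * v) ≡ 2 * (d * v)
        swap = solve-∀
        shuffle : ∀ r k p → 2 * (r * r * p + 2 * r * (2 * r) * (k * p)) ≡ 2 * (1 + 4 * k) * (r * r) * p
        shuffle = solve-∀
        levels<Ω : All (λ a → suc (level a) < Ω) F
        levels<Ω = All.zipWith (λ (a≢0 , a≤) → ≤-trans (s≤s (s≤s (level≤ {{a≢0}} a≤))) 1+m<Ω) (F≢0 , F≤)
        c₀≤ : c₀ ≤ suc (suc t)
        c₀≤ = m≤n⇒m≤1+n (m≤n⇒m≤1+n c₀≤t)
        VΩ≤ : D * V Ω ≤ initial * 2 ^ Ω + 2 ^ suc (suc t) * 2 ^ suc (suc t) * (2 ^ K * 2 ^ Ω)
        -- The block index `suc (suc t)` has endpoint exactly `Ω`.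
        VΩ≤ = subst (λ c → D * V ((2 ^ c) ^ K) ≤ initial * 2 ^ Ω + 2 ^ c * 2 ^ c * (2 ^ K * 2 ^ Ω))
          (m+[n∸m]≡n c₀≤) (V≤ (suc (suc t) ∸ c₀) (≤-reflexive (m+[n∸m]≡n c₀≤)))

      -- With `j = m ∸ levels ys`, sparsity leaves at most `2 ^ j / (D * r ^ e)` pivots, and
      -- `weight-levels` expresses `2 ^ j` as `2 ^ m` times the product of the weights over
      -- `(2 ^ Ω) ^ n`.
      pivotProducts≤ : ∀ n → suc n ≤ K → ∀ {ys} → ys ∈ tuples F n →
        D * r ^ e * (2 ^ Ω) ^ n * length (pivotProducts F m n ys) ≤ 2 ^ m * product (map (weight Ω) ys)
      pivotProducts≤ n n<K {ys} ys∈ with m ≤? suc n * (m ∸ levels ys)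
      ... | no  _  = ≤-trans (≤-reflexive (*-zeroʳ (D * r ^ e * (2 ^ Ω) ^ n))) z≤n
      ... | yes m≤ rewrite length-map (_* product ys) (filter (_≤? 4 ^ (m ∸ levels ys)) F) = begin
        D * r ^ e * (2 ^ Ω) ^ n * count F (4 ^ j)          ≡⟨ swap (D * r ^ e) ((2 ^ Ω) ^ n) _ ⟩
        D * r ^ e * count F (4 ^ j) * (2 ^ Ω) ^ n          ≤⟨ *-monoˡ-≤ ((2 ^ Ω) ^ n) (sparse t c₀≤t rᴷ≤j j<Ω) ⟩
        2 ^ j * (2 ^ Ω) ^ n                                ≡⟨ cong (2 ^ j *_) (weight-levels Ω F levels≤Ω n ys∈) ⟨
        2 ^ j * (W * 2 ^ s)                                ≡⟨ shuffle (2 ^ j) W (2 ^ s) ⟩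
        2 ^ j * 2 ^ s * W                                  ≡⟨ cong (_* W) (^-distribˡ-+-* 2 j s) ⟨
        2 ^ (j + s) * W                                    ≡⟨ cong (λ i → 2 ^ i * W) (m∸n+n≡m s≤m) ⟩
        2 ^ m * W                                          ∎
        where
        s = levels ys
        j = m ∸ s
        W = product (map (weight Ω) ys)
        swap : ∀ a b c → a * b * c ≡ a * c * b
        swap = solve-∀
        shuffle : ∀ a b c → a * (b * c) ≡ a * c * b
        shuffle = solve-∀
        -- The test gives only `j ≥ m / K`; passing from `R` to `r = R / 2` divides the K-th power
        -- by `2 ^ K`, which exceeds `K`.
        rᴷ≤j : r ^ K ≤ j
        rᴷ≤j = *-cancelˡ-≤ (2 ^ K) {{m^n≢0 2 K}} (begin
          2 ^ K * r ^ K     ≡⟨ 2^sucᴷ t ⟨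
          m                 ≤⟨ m≤ ⟩
          suc n * j         ≤⟨ *-monoˡ-≤ j (≤-trans n<K (<⇒≤ (n<2^n K))) ⟩
          2 ^ K * j         ∎)
        j<Ω : j < Ω
        j<Ω = ≤-<-trans (m∸n≤m m s) (<-trans (n<1+n m) 1+m<Ω)
        -- As `j` is positive, the subtraction `m ∸ s` is not truncated.
        s≤m : s ≤ m
        s≤m = <⇒≤ (m∸n≢0⇒n<m (m<n⇒n≢0 (<-≤-trans (>-nonZero⁻¹ (r ^ K) {{2^^≢0 t K}}) rᴷ≤j)))
        levels≤Ω : All (λ a → level a ≤ Ω) F
        levels≤Ω = All.zipWith (λ (a≢0 , a≤) → ≤-trans (level≤ {{a≢0}} a≤) (<⇒≤ (<-trans (n<1+n m) 1+m<Ω))) (F≢0 , F≤)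

      -- Summing `pivotProducts≤` over all tuples produces `H ^ n`, to which `H≤` applies; the
      -- factor `(2 ^ Ω) ^ n` due to the integral weights cancels.
      length-products : ∀ n → suc n ≤ K →
        D ^ suc n * r ^ e * length (products F m n) ≤ 2 ^ m * (B e * (R * R)) ^ n
      length-products n n<K = *-cancelˡ-≤ P {{2^^≢0 Ω n}} (begin
        P * (D ^ suc n * r ^ e * L)          ≡⟨ shuffle₁ P D (D ^ n) (r ^ e) L ⟩
        D ^ n * (D * r ^ e * P * L)          ≤⟨ *-monoʳ-≤ (D ^ n) (length-concatMap-≤ (pivotProducts F m n) (product ∘ map (weight Ω))
                                                  (D * r ^ e * P) (2 ^ m) (tuples F n) (pivotProducts≤ n n<K)) ⟩
        D ^ n * (2 ^ m * sum (map (product ∘ map (weight Ω)) (tuples F n)))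
                                             ≡⟨ cong (λ h → D ^ n * (2 ^ m * h)) (∑tuples (weight Ω) F n) ⟩
        D ^ n * (2 ^ m * H ^ n)              ≡⟨ shuffle₂ (D ^ n) (2 ^ m) (H ^ n) ⟩
        2 ^ m * (D ^ n * H ^ n)              ≡⟨ cong (2 ^ m *_) (^-distrib-* D H n) ⟨
        2 ^ m * (D * H) ^ n                  ≤⟨ *-monoʳ-≤ (2 ^ m) (^-monoˡ-≤ n H≤) ⟩
        2 ^ m * (B e * (R * R) * 2 ^ Ω) ^ n  ≡⟨ cong (2 ^ m *_) (^-distrib-* (B e * (R * R)) (2 ^ Ω) n) ⟩
        2 ^ m * ((B e * (R * R)) ^ n * P)    ≡⟨ shuffle₃ (2 ^ m) _ P ⟩
        P * (2 ^ m * (B e * (R * R)) ^ n)    ∎)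
        where
        P = (2 ^ Ω) ^ n
        L = length (products F m n)
        shuffle₁ : ∀ p d x q l → p * (d * x * q * l) ≡ x * (d * q * p * l)
        shuffle₁ = solve-∀
        shuffle₂ : ∀ d m h → d * (m * h) ≡ m * (d * h)
        shuffle₂ = solve-∀
        shuffle₃ : ∀ m b p → m * (b * p) ≡ p * (m * b)
        shuffle₃ = solve-∀

      -- The powers of the logarithm cancel exactly: the two counts carry `R ^ (2 * κ)` and
      -- `R ^ (2 * μ)`, each divided by `r ^ e`, and `κ + μ ≡ e` with `R = 2 * r` leaves only
      -- `4 ^ e`.
      products*products : ∀ κ μ → κ + μ ≡ e →
        D ^ (2 + e) * (length (products F m κ) * length (products F m μ)) ≤ 4 ^ m * (4 * B e) ^ e
      products*products κ μ κ+μ≡e = *-cancelˡ-≤ (r ^ e * r ^ e) {{m*n≢0 (r ^ e) (r ^ e)}} (begin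
        r ^ e * r ^ e * (D ^ (2 + e) * (L κ * L μ))
          ≡⟨ cong (λ i → r ^ e * r ^ e * (D * (D * i) * (L κ * L μ))) (trans (cong (D ^_) (sym κ+μ≡e)) (^-distribˡ-+-* D κ μ)) ⟩
        r ^ e * r ^ e * (D * (D * (D ^ κ * D ^ μ)) * (L κ * L μ))
          ≡⟨ shuffle₁ (r ^ e) D (D ^ κ) (D ^ μ) (L κ) (L μ) ⟩
        D ^ suc κ * r ^ e * L κ * (D ^ suc μ * r ^ e * L μ)
          ≤⟨ *-mono-≤ (length-products κ (n<K κ μ κ+μ≡e)) (length-products μ (n<K μ κ (trans (+-comm μ κ) κ+μ≡e))) ⟩
        2 ^ m * b ^ κ * (2 ^ m * b ^ μ)
          ≡⟨ shuffle₂ (2 ^ m) (b ^ κ) (b ^ μ) ⟩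
        2 ^ m * 2 ^ m * (b ^ κ * b ^ μ)
          ≡⟨ cong₂ _*_ (sym (^-distrib-* 2 2 m)) (trans (sym (^-distribˡ-+-* b κ μ)) (cong (b ^_) κ+μ≡e)) ⟩
        4 ^ m * b ^ e
          ≡⟨ cong (λ i → 4 ^ m * i ^ e) (shuffle₃ (B e) r) ⟩
        4 ^ m * (4 * B e * (r * r)) ^ e
          ≡⟨ cong (4 ^ m *_) (trans (^-distrib-* (4 * B e) (r * r) e) (cong ((4 * B e) ^ e *_) (^-distrib-* r r e))) ⟩
        4 ^ m * ((4 * B e) ^ e * (r ^ e * r ^ e))
          ≡⟨ shuffle₄ (4 ^ m) ((4 * B e) ^ e) (r ^ e) ⟩
        r ^ e * r ^ e * (4 ^ m * (4 * B e) ^ e) ∎)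
        where
        instance _ = 2^^≢0 t e
        L : ℕ → ℕ
        L n = length (products F m n)
        b = B e * (R * R)
        n<K : ∀ n n′ → n + n′ ≡ e → suc n ≤ K
        n<K n n′ refl = s≤s (m≤n⇒m≤1+n (m≤m+n n n′))
        shuffle₁ : ∀ z d x y p q → z * z * (d * (d * (x * y)) * (p * q)) ≡ d * x * z * p * (d * y * z * q)
        shuffle₁ = solve-∀
        shuffle₂ : ∀ m x y → m * x * (m * y) ≡ m * m * (x * y)
        shuffle₂ = solve-∀
        shuffle₃ : ∀ b r → b * (2 * r * (2 * r)) ≡ 4 * b * (r * r)
        shuffle₃ = solve-∀
        shuffle₄ : ∀ m b z → m * (b * (z * z)) ≡ z * z * (m * b)
        shuffle₄ = solve-∀

  -- From many sums to a dense scale.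

  -- The first factor is kept apart, so `n` counts the remaining ones: k - 1 or l - 1.
  ProductOf : Pred ℕ 0ℓ → ℕ → ℕ → Set
  ProductOf A n x = ∃₂ λ a xs → A a × All A xs × length xs ≡ n × x ≡ a * product xs

  SumOfProducts : Pred ℕ 0ℓ → ℕ → ℕ → ℕ → Set
  SumOfProducts A κ μ x = ∃₂ λ y z → ProductOf A κ y × ProductOf A μ z × x ≡ y + z

  -- An injection replaces a cardinality because `P` need not be decidable; `1 / Q` plays the role
  -- of a lower density.
  Many : Pred ℕ 0ℓ → ℕ → ℕ → Set
  Many P Q n = ∃ λ M → Σ[ f ∈ (Fin M → ℕ) ] Injective _≡_ _≡_ f × (∀ i → f i ≤ n × P (f i)) × n < Q * M

  -- With α = e / (2 + e) this says |F ∩ [1, X]| ≥ √X / (D (log₄ X)^α) at X = 4^j.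
  DenseAt : Pred ℕ 0ℓ → ℕ → ℕ → ℕ → Set
  DenseAt A e D j = ∃ λ F → Unique F × All A F × (2 ^ j) ^ (2 + e) ≤ (D * count F (4 ^ j)) ^ (2 + e) * j ^ e

  -- Chosen for the final contradiction: one factor `D` is at least `Q`, and `D ^ e` is at least the
  -- `(4 * B e) ^ e` from `products*products`.
  densityConstant : ℕ → ℕ → ℕ
  densityConstant e Q = Q * (4 * B e)

  densityConstant≢0 : ∀ e Q .{{_ : NonZero Q}} → NonZero (densityConstant e Q)
  densityConstant≢0 e Q = m*n≢0 Q (4 * B e)

  module _ {A : Pred ℕ 0ℓ} (0∉A : ¬ A 0) where

    A≢0 : ∀ {a} → A a → NonZero a
    A≢0 {zero}  0∈A = contradiction 0∈A 0∉A
    A≢0 {suc _} _   = _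

    factors : ∀ {n x} → ProductOf A n x → List ℕ
    factors (a , xs , _) = a ∷ xs

    factors-A : ∀ {n x} (p : ProductOf A n x) → All A (factors p)
    factors-A (_ , _ , a∈ , xs∈ , _) = a∈ ∷ xs∈

    factors≤ : ∀ {n x} (p : ProductOf A n x) → All (_≤ x) (factors p)
    factors≤ p@(a , xs , _ , _ , _ , refl) = All.tabulate (∈⇒≤product (All.map A≢0 (factors-A p)))

    ProductOf⇒∈-products : ∀ {F m n x} → All NonZero F → (p : ProductOf A n x) →
      All (_∈ F) (factors p) → x ≤ 4 ^ m → x ∈ products F m n
    ProductOf⇒∈-products {m = m} F≢0 (a , xs , _ , _ , refl , refl) (a∈ ∷ xs∈) x≤ = ∈-products {m = m} F≢0 xs a∈ xs∈ x≤

    -- A need not be decidable, so the index j is searched for in the finite list F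
    -- of all elements of A that witness the sums up to 4^m.
    many⇒dense : ∀ κ μ Q N₀ .{{_ : NonZero Q}} → (∀ n → N₀ ≤ n → Many (SumOfProducts A κ μ) Q n) →
      ∀ N → ∃ λ j → N ≤ j × DenseAt A (κ + μ) (densityConstant (κ + μ) Q) j
    many⇒dense κ μ Q N₀ many N = search (many (4 ^ m) N₀≤)
      where
      e = κ + μ
      D = densityConstant e Q
      instance _ = densityConstant≢0 e Q
      -- `initial` is independent of the last parameter of `Sparse`, so 0 may stand there before `t`
      -- is known. The summands make `t` at least `N`, `initial` and `N₀`.
      t = N + (Sparse.initial e D N 0 + N₀)
      open Sparse e D N t using (K; m; Ω; initial; SparseList; products*products)
      open ≤-Reasoning

      R = 2 ^ suc t

      instance
        R≢0 : NonZero R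
        R≢0 = m^n≢0 2 (suc t)

      t≤R : t ≤ R
      t≤R = <⇒≤ (<-trans (n<1+n t) (n<2^n (suc t)))

      N₀≤ : N₀ ≤ 4 ^ m
      N₀≤ = begin
        N₀              ≤⟨ ≤-trans (m≤n+m N₀ initial) (m≤n+m (initial + N₀) N) ⟩
        t               ≤⟨ t≤R ⟩
        R               ≤⟨ m≤m*n R (R ^ (1 + e)) {{m^n≢0 R (1 + e)}} ⟩
        m               ≤⟨ <⇒≤ (n<2^n m) ⟩
        2 ^ m           ≤⟨ ^-monoˡ-≤ m (s≤s (s≤s z≤n)) ⟩
        4 ^ m           ∎

      search : Many (SumOfProducts A κ μ) Q (4 ^ m) → ∃ λ j → N ≤ j × DenseAt A e D j
      search (M , f , f-inj , f∈ , 4^m<QM) =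
        -- The lower limit `(2 ^ N) ^ K` is the first controlled block endpoint and forces `N ≤ j`.
        -- If the search fails, `F` is sparse and has too few sums.
        case anyUpTo? (λ j → (2 ^ N) ^ K ≤? j ×-dec (2 ^ j) ^ K ≤? (D * count F (4 ^ j)) ^ K * j ^ e) Ω of λ where
          (yes (j , _ , ≤j , dense)) → j , ≤-trans N≤ ≤j , F , deduplicate-! _≟_ _ , F-A , dense
          (no none)                  → contradiction 4^m<QM (≤⇒≯ (QM≤4^m none))
        where
        terms : Fin M → List ℕ
        terms i = let _ , _ , p , q , _ = proj₂ (f∈ i) in factors p ++ factors q

        F : List ℕ
        F = deduplicate _≟_ (concat (tabulate terms))

        F-all : ∀ {P : Pred ℕ 0ℓ} → (∀ i → All P (terms i)) → All P F
        F-all all = All.tabulate λ a∈ →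
          All.lookup (All.concat⁺ (All.tabulate⁺ all)) (∈-deduplicate⁻ _≟_ (concat (tabulate terms)) a∈)

        terms⊆F : ∀ i → All (_∈ F) (terms i)
        terms⊆F i = All.tabulate λ a∈ → ∈-deduplicate⁺ _≟_ (∈-concat⁺′ a∈ (∈-tabulate⁺ i))

        F-A : All A F
        F-A = F-all λ i → let _ , _ , p , q , _ = proj₂ (f∈ i) in All.++⁺ (factors-A p) (factors-A q)

        F≢0 : All NonZero F
        F≢0 = All.map A≢0 F-A

        F≤ : All (_≤ 4 ^ m) F
        F≤ = F-all λ i → let fi≤ , y , z , p , q , eq = f∈ i ; y+z≤ = ≤-trans (≤-reflexive (sym eq)) fi≤ in
          All.++⁺ (All.map (λ a≤ → ≤-trans a≤ (m+n≤o⇒m≤o y y+z≤)) (factors≤ p))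
                  (All.map (λ a≤ → ≤-trans a≤ (m+n≤o⇒n≤o y y+z≤)) (factors≤ q))

        N≤ : N ≤ (2 ^ N) ^ K
        N≤ = ≤-trans (<⇒≤ (n<2^n N)) (m≤m*n (2 ^ N) ((2 ^ N) ^ (1 + e)) {{m^n≢0 (2 ^ N) (1 + e) {{m^n≢0 2 N}}}})

        sums : List ℕ
        sums = cartesianProductWith _+_ (products F m κ) (products F m μ)

        f∈sums : ∀ i → f i ∈ sums
        f∈sums i = let fi≤ , y , z , p , q , eq = f∈ i ; y+z≤ = ≤-trans (≤-reflexive (sym eq)) fi≤ in
          subst (_∈ sums) (sym eq) (∈-cartesianProductWith⁺ _+_
            (ProductOf⇒∈-products {m = m} F≢0 p (All.++⁻ˡ (factors p) (terms⊆F i)) (m+n≤o⇒m≤o y y+z≤))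
            (ProductOf⇒∈-products {m = m} F≢0 q (All.++⁻ʳ (factors p) (terms⊆F i)) (m+n≤o⇒n≤o y y+z≤)))

        M≤ : M ≤ length (products F m κ) * length (products F m μ)
        M≤ = ≤-trans (injective⇒≤-length f f-inj sums f∈sums)
          (≤-reflexive (length-cartesianProductWith _+_ (products F m κ) (products F m μ)))

        module _ (none : ¬ ∃ λ j → j < Ω × (2 ^ N) ^ K ≤ j × (2 ^ j) ^ K ≤ (D * count F (4 ^ j)) ^ K * j ^ e) where

          -- Compare K-th powers: `(r ^ e) ^ K` equals `(r ^ K) ^ e`, which is at most `j ^ e`, so
          -- the failure of density at `j` applies.
          sparse : ∀ c → N ≤ c → ∀ {j} → (2 ^ c) ^ K ≤ j → j < Ω → D * (2 ^ c) ^ e * count F (4 ^ j) ≤ 2 ^ j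
          sparse c N≤c {j} ≤j j<Ω = ^-cancelˡ-≤ K (begin
            (D * r ^ e * x) ^ K             ≡⟨ cong (_^ K) (swap D (r ^ e) x) ⟩
            (D * x * r ^ e) ^ K             ≡⟨ ^-distrib-* (D * x) (r ^ e) K ⟩
            (D * x) ^ K * (r ^ e) ^ K       ≡⟨ cong ((D * x) ^ K *_) (trans (^-*-assoc r e K)
                                                 (trans (cong (r ^_) (*-comm e K)) (sym (^-*-assoc r K e)))) ⟩
            (D * x) ^ K * (r ^ K) ^ e       ≤⟨ *-monoʳ-≤ ((D * x) ^ K) (^-monoˡ-≤ e ≤j) ⟩
            (D * x) ^ K * j ^ e             ≤⟨ ≰⇒≥ (λ dense → none (j , j<Ω , ≤-trans (^-monoˡ-≤ K (^-monoʳ-≤ 2 N≤c)) ≤j , dense)) ⟩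
            (2 ^ j) ^ K                     ∎)
            where
            r = 2 ^ c
            x = count F (4 ^ j)
            swap : ∀ a b c → a * b * c ≡ a * c * b
            swap = solve-∀

          sparseList : SparseList F
          sparseList = record
            { sparse = sparse
            ; unique   = deduplicate-! _≟_ _
            ; F≢0      = F≢0
            ; F≤       = F≤
            ; c₀≤t     = m≤m+n N _
            ; initial≤ = ≤-trans (≤-trans (m≤m+n initial N₀) (m≤n+m (initial + N₀) N)) (≤-trans t≤R (m≤m*n R R))
            ; D≢0      = densityConstant≢0 e Q
            }

          QM≤4^m : Q * M ≤ 4 ^ m
          QM≤4^m = *-cancelˡ-≤ (D ^ K) {{m^n≢0 D K}} (begin
            D ^ K * (Q * M)                   ≤⟨ *-monoʳ-≤ (D ^ K) (*-monoʳ-≤ Q M≤) ⟩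
            D ^ K * (Q * LL)                  ≡⟨ swap (D ^ K) Q LL ⟩
            Q * (D ^ K * LL)                  ≤⟨ *-monoʳ-≤ Q (products*products sparseList κ μ refl) ⟩
            Q * (4 ^ m * (4 * B e) ^ e)       ≤⟨ *-mono-≤ (m≤m*n Q (4 * B e)) (*-monoʳ-≤ (4 ^ m)
                                                   (≤-trans (^-monoˡ-≤ e (m≤n*m (4 * B e) Q)) (m≤n*m (D ^ e) D))) ⟩
            D * (4 ^ m * (D * D ^ e))         ≡⟨ shuffle D (4 ^ m) (D * D ^ e) ⟩
            D ^ K * 4 ^ m                     ∎)
            where
            LL = length (products F m κ) * length (products F m μ)
            swap : ∀ d q l → d * (q * l) ≡ q * (d * l)
            swap = solve-∀
            shuffle : ∀ d m x → d * (m * x) ≡ d * x * m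
            shuffle = solve-∀

open import Defs
open import Algebra.Definitions.RawSemiring ℚ.+-*-rawSemiring using (_^_) renaming (sum to ∑)
open import Algebra.Properties.CommutativeSemiring.Exp (CommutativeRing.commutativeSemiring ℚ.+-*-commutativeRing) using (^-distrib-*)
open import Algebra.Properties.Monoid.Sum ℚ.+-0-monoid using (sum-cong-≗)
open Auxiliary
open Counting using (SumOfProducts; ProductOf; Many; DenseAt; many⇒dense; densityConstant; densityConstant≢0; count; lookup-injective; n<2^n)

-- Rational arithmetic and a lower bound for the logarithm.

fromℕ-^ : ∀ m n → fromℕ (m ℕ.^ n) ≡ fromℕ m ^ n
fromℕ-^ m zero    = refl
fromℕ-^ m (suc n) = trans (fromℕ-* m (m ℕ.^ n)) (cong (fromℕ m ℚ.*_) (fromℕ-^ m n))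

^-cancelˡ-< : ∀ {p q} n → 0ℚ ℚ.≤ q → p ^ n ℚ.< q ^ n → p ℚ.< q
^-cancelˡ-< n 0≤q pⁿ<qⁿ = ℚ.≰⇒> λ q≤p → ℚ.<-irrefl refl (ℚ.<-≤-trans pⁿ<qⁿ (^-mono n 0≤q q≤p))

archimedean : ∀ {q} → 0ℚ ℚ.< q → ∃ λ Q → 1ℚ ℚ.≤ fromℕ (suc Q) ℚ.* q
archimedean {q@(mkℚ (ℤ.+ zero) d _)}  0<q = contradiction (ℚ.positive 0<q) λ ()
archimedean {q@(mkℚ (ℤ.-[1+ _ ]) d _)} 0<q = contradiction (ℚ.positive 0<q) λ ()
-- A positive numerator is at least 1, so the denominator of `q` suffices.
archimedean {q@(mkℚ (ℤ.+ suc a) d _)} 0<q = d , subst (ℚ._≤ fromℕ (suc d) ℚ.* q) (unit-fraction d)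
  (*-monoʳ (ℚ.<⇒≤ (fromℕ-pos (suc d))) (subst (unit d ℚ.≤_) (ℚ.fromℚᵘ-toℚᵘ q)
    (fromℚᵘ-≤ {ℚᵘ.mkℚᵘ (ℤ.+ 1) d} {ℚ.toℚᵘ q} (ℚᵘ.*≤* (ℤ.*-monoʳ-≤-nonNeg (ℤ.+ suc d) {ℤ.+ 1} {ℤ.+ suc a} (ℤ.+≤+ (s≤s z≤n)))))))

-- The denominators run from `a + 1` to `a + n`; `lowerSum X 1` is the case `a = 1`.
harmonic : ℕ → ℕ → ℚ
harmonic a n = ∑ {n} λ i → unit (a ℕ.+ toℕ i)

harmonic-suc : ∀ a n → harmonic a (suc n) ≡ unit a ℚ.+ harmonic (suc a) n
harmonic-suc a n = cong₂ ℚ._+_ (cong unit (ℕ.+-identityʳ a)) (sum-cong-≗ {n} λ i → cong unit (ℕ.+-suc a (toℕ i)))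

harmonic-+ : ∀ s {a n u} → a ℕ.+ s ℕ.≤ suc u →
  fromℕ s ℚ.* unit u ℚ.+ harmonic (a ℕ.+ s) n ℚ.≤ harmonic a (s ℕ.+ n)
harmonic-+ zero {a} {n} {u} _ = ℚ.≤-reflexive (trans
  (cong₂ ℚ._+_ (ℚ.*-zeroˡ (unit u)) (cong (λ a → harmonic a n) (ℕ.+-identityʳ a))) (ℚ.+-identityˡ _))
harmonic-+ (suc s) {a} {n} {u} a+s≤ = begin
  fromℕ (suc s) ℚ.* unit u ℚ.+ h                   ≡⟨ cong (λ i → i ℚ.* unit u ℚ.+ h) (fromℕ-suc s) ⟩
  (1ℚ ℚ.+ fromℕ s) ℚ.* unit u ℚ.+ h                ≡⟨ cong (ℚ._+ h) (ℚ.*-distribʳ-+ (unit u) 1ℚ (fromℕ s)) ⟩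
  1ℚ ℚ.* unit u ℚ.+ fromℕ s ℚ.* unit u ℚ.+ h       ≡⟨ cong (λ i → i ℚ.+ fromℕ s ℚ.* unit u ℚ.+ h) (ℚ.*-identityˡ (unit u)) ⟩
  unit u ℚ.+ fromℕ s ℚ.* unit u ℚ.+ h              ≡⟨ ℚ.+-assoc (unit u) _ h ⟩
  unit u ℚ.+ (fromℕ s ℚ.* unit u ℚ.+ h)            ≡⟨ cong (λ b → unit u ℚ.+ (fromℕ s ℚ.* unit u ℚ.+ harmonic b n)) (ℕ.+-suc a s) ⟩
  unit u ℚ.+ (fromℕ s ℚ.* unit u ℚ.+ harmonic (suc a ℕ.+ s) n)
    ≤⟨ ℚ.+-mono-≤ (unit-≤ (ℕ.s≤s⁻¹ (ℕ.≤-trans (s≤s (ℕ.m≤m+n a s)) 1+a+s≤)))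
         (harmonic-+ s {suc a} {n} {u} 1+a+s≤) ⟩
  unit a ℚ.+ harmonic (suc a) (s ℕ.+ n)            ≡⟨ harmonic-suc a (s ℕ.+ n) ⟨
  harmonic a (suc s ℕ.+ n)                         ∎
  where
  open ℚ.≤-Reasoning
  h = harmonic (a ℕ.+ suc s) n
  1+a+s≤ : suc a ℕ.+ s ℕ.≤ suc u
  1+a+s≤ = subst (ℕ._≤ suc u) (ℕ.+-suc a s) a+s≤

½-unit : ∀ s {u} → suc u ≡ s ℕ.+ s → fromℕ s ℚ.* unit u ≡ ½
½-unit s {u} eq = begin
  fromℕ s ℚ.* unit u                       ≡⟨ cong (ℚ._* unit u) (ℚ.*-identityˡ (fromℕ s)) ⟨
  (½ ℚ.* fromℕ 2) ℚ.* fromℕ s ℚ.* unit u   ≡⟨ cong (ℚ._* unit u) (ℚ.*-assoc ½ (fromℕ 2) (fromℕ s)) ⟩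
  ½ ℚ.* (fromℕ 2 ℚ.* fromℕ s) ℚ.* unit u   ≡⟨ cong (λ i → ½ ℚ.* i ℚ.* unit u) (fromℕ-* 2 s) ⟨
  ½ ℚ.* fromℕ (2 ℕ.* s) ℚ.* unit u         ≡⟨ cong (λ i → ½ ℚ.* fromℕ i ℚ.* unit u) (trans (cong (s ℕ.+_) (ℕ.+-identityʳ s)) (sym eq)) ⟩
  ½ ℚ.* fromℕ (suc u) ℚ.* unit u           ≡⟨ ℚ.*-assoc ½ (fromℕ (suc u)) (unit u) ⟩
  ½ ℚ.* (fromℕ (suc u) ℚ.* unit u)         ≡⟨ cong (½ ℚ.*_) (unit-fraction u) ⟩
  ½ ℚ.* 1ℚ                                 ≡⟨⟩
  ½                                        ∎
  where open ≡-Reasoning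

-- Oresme's argument: the `2 ^ b` terms with denominators from `2 ^ b + 1` to `2 ^ suc b` contribute
-- at least one half, and there is room for `d` such octaves.
harmonic-≥ : ∀ d b n → 2 ℕ.^ (b ℕ.+ d) ℕ.≤ 2 ℕ.^ b ℕ.+ n → fromℕ d ℚ.* ½ ℚ.≤ harmonic (2 ℕ.^ b) n
harmonic-≥ zero    b n _ = sum-nonNeg n λ i → unit-pos (2 ℕ.^ b ℕ.+ toℕ i)
harmonic-≥ (suc d) b n ≤n = begin
  fromℕ (suc d) ℚ.* ½                                   ≡⟨ cong (ℚ._* ½) (fromℕ-suc d) ⟩
  (1ℚ ℚ.+ fromℕ d) ℚ.* ½                                ≡⟨ ℚ.*-distribʳ-+ ½ 1ℚ (fromℕ d) ⟩
  1ℚ ℚ.* ½ ℚ.+ fromℕ d ℚ.* ½                            ≡⟨ cong (ℚ._+ fromℕ d ℚ.* ½) (½-unit s u≡) ⟨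
  fromℕ s ℚ.* unit u ℚ.+ fromℕ d ℚ.* ½                  ≤⟨ ℚ.+-monoʳ-≤ (fromℕ s ℚ.* unit u) (subst (λ i → fromℕ d ℚ.* ½ ℚ.≤ harmonic i n′) 2^suc
                                                             (harmonic-≥ d (suc b) n′ ≤n′)) ⟩
  fromℕ s ℚ.* unit u ℚ.+ harmonic (s ℕ.+ s) n′          ≤⟨ harmonic-+ s {s} {n′} {u} (ℕ.≤-reflexive (sym u≡)) ⟩
  harmonic s (s ℕ.+ n′)                                 ≡⟨ cong (harmonic s) s+n′≡n ⟩
  harmonic s n                                          ∎
  where
  open ℚ.≤-Reasoning
  s = 2 ℕ.^ b
  u = ℕ.pred (s ℕ.+ s)
  2^suc : 2 ℕ.^ suc b ≡ s ℕ.+ s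
  2^suc = cong (s ℕ.+_) (ℕ.+-identityʳ s)
  u≡ : suc u ≡ s ℕ.+ s
  u≡ = ℕ.suc-pred (s ℕ.+ s) {{ℕ.>-nonZero (ℕ.≤-trans (ℕ.m^n>0 2 b) (ℕ.m≤m+n s s))}}
  ≤n″ : 2 ℕ.^ (suc b ℕ.+ d) ℕ.≤ s ℕ.+ n
  ≤n″ = subst (λ i → 2 ℕ.^ i ℕ.≤ s ℕ.+ n) (ℕ.+-suc b d) ≤n
  s≤n : s ℕ.≤ n
  s≤n = ℕ.+-cancelˡ-≤ s s n (ℕ.≤-trans (ℕ.≤-reflexive (sym 2^suc))
    (ℕ.≤-trans (ℕ.^-monoʳ-≤ 2 (ℕ.m≤m+n (suc b) d)) ≤n″))
  n′ = n ℕ.∸ s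
  s+n′≡n : s ℕ.+ n′ ≡ n
  s+n′≡n = ℕ.m+[n∸m]≡n s≤n
  ≤n′ : 2 ℕ.^ (suc b ℕ.+ d) ℕ.≤ 2 ℕ.^ suc b ℕ.+ n′
  ≤n′ = ℕ.≤-trans ≤n″ (ℕ.≤-reflexive (trans (cong (s ℕ.+_) (sym s+n′≡n))
    (trans (sym (ℕ.+-assoc s s n′)) (cong (ℕ._+ n′) (sym 2^suc)))))

-- The coarsest Darboux sum suffices: `4 ^ j` spans `2 * j` octaves, so the sum is at least `j`.
-- Claiming only half of this gives the strict inequality that the cut requires.
½j<log : ∀ j .{{_ : NonZero j}} → fromℕ j ℚ.* ½ ℚ.< lowerSum (4 ℕ.^ j) 1
½j<log j = ℚ.<-≤-trans (*-monoˡ-< (ℚ.positive⁻¹ ½) (fromℕ-< (ℕ.m<m*n j 2 (s≤s (s≤s z≤n)))))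
  (harmonic-≥ (j ℕ.* 2) 0 (1 ℕ.* (4 ℕ.^ j ℕ.∸ 1)) (ℕ.≤-reflexive (begin
    2 ℕ.^ (j ℕ.* 2)                    ≡⟨ cong (2 ℕ.^_) (ℕ.*-comm j 2) ⟩
    2 ℕ.^ (2 ℕ.* j)                    ≡⟨ ℕ.^-*-assoc 2 2 j ⟨
    4 ℕ.^ j                            ≡⟨ ℕ.m+[n∸m]≡n (ℕ.m^n>0 4 j) ⟨
    1 ℕ.+ (4 ℕ.^ j ℕ.∸ 1)              ≡⟨ cong suc (ℕ.*-identityˡ (4 ℕ.^ j ℕ.∸ 1)) ⟨
    1 ℕ.+ 1 ℕ.* (4 ℕ.^ j ℕ.∸ 1)        ∎)))
  where open ≡-Reasoning

-- Comparison with the real bound.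

-- For `p` in the left-hand cut, `p * s < r` with `r < c * h`, where `h` is the exact square root of
-- `X` and `s` is at least (log X)^α. Density bounds the quotient of `c * h` by the count `y` by
-- `s`, so `y ≤ p` would force `c * h < c * h`.
dense⇒large : ∀ {A : Pred ℕ 0ℓ} {e D : ℕ} (c : ℚ) (0<c : 0ℚ ℚ.< c) a b .{{_ : NonZero b}} → a ≡ e → b ≡ 2 ℕ.+ e →
  0 ∉ A → c ℚ.* fromℕ D ≡ ½ → ∀ {j} .{{_ : NonZero j}} (1<X : 1 ℕ.< 4 ℕ.^ j) → DenseAt A e D j →
  real (record { real = fromℚ c ; positive = 0<c } * √ (fromℕ⁺ (4 ℕ.^ j) (<⇒≤ 1<X)) ÷ log (4 ℕ.^ j) 1<X ^[ a / b ])
    ≤ ∣ A ∩[1, 4 ℕ.^ j ]∣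
dense⇒large {A} {D = D} c 0<c e K refl refl 0∉A cD≡½ {j} 1<X (F , unique , F⊆A , dense)
  {p} (r , s , (r₁ , r₂ , (r₁<c , 0<r₁) , ((q₂ , ρ₂ , 0<q₂ , (ρ₂<X , 0<ρ₂) , q₂²≤ρ₂ , r₂<q₂) , 0<r₂) , r<r₁r₂) , s∉ , ps<r) =
  count F X , (lookup G , lookup-injective (Unique.filter⁺ (ℕ._≤? X) unique) , member) , ℚ.≰⇒> y≰p
  where
  open ℚ.≤-Reasoning
  X = 4 ℕ.^ j
  G = filter (ℕ._≤? X) F
  y = fromℕ (count F X)
  h = fromℕ (2 ℕ.^ j)

  member : ∀ i → (1 ℕ.≤ lookup G i × lookup G i ℕ.≤ X) × A (lookup G i)
  member i = let a∈F , a≤X = ∈-filter⁻ (ℕ._≤? X) {xs = F} (∈-lookup i) ; a∈A = All.lookup F⊆A a∈F in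
    (ℕ.n≢0⇒n>0 (λ a≡0 → 0∉A (subst A a≡0 a∈A)) , a≤X) , a∈A

  0<h : 0ℚ ℚ.< h
  0<h = fromℕ-pos (2 ℕ.^ j) {{ℕ.m^n≢0 2 j}}

  q₂<h : q₂ ℚ.< h
  q₂<h = ^-cancelˡ-< 2 (ℚ.<⇒≤ 0<h) (begin-strict
    q₂ ^ 2                   ≤⟨ q₂²≤ρ₂ ⟩
    ρ₂ ^ 1                   ≡⟨ ℚ.*-identityʳ ρ₂ ⟩
    ρ₂                       <⟨ ρ₂<X ⟩
    fromℕ X                  ≡⟨ cong fromℕ (trans (ℕ.^-*-assoc 2 2 j) (trans (cong (2 ℕ.^_) (ℕ.*-comm 2 j)) (sym (ℕ.^-*-assoc 2 j 2)))) ⟩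
    fromℕ ((2 ℕ.^ j) ℕ.^ 2)  ≡⟨ fromℕ-^ (2 ℕ.^ j) 2 ⟩
    h ^ 2                    ∎)

  r<ch : r ℚ.< c ℚ.* h
  r<ch = ℚ.<-≤-trans r<r₁r₂ (*-mono (ℚ.<⇒≤ 0<r₁) (ℚ.<⇒≤ 0<h) (ℚ.<⇒≤ r₁<c) (ℚ.<⇒≤ (r₂<q₂ <⟫ q₂<h)))

  0<y : 0ℚ ℚ.< y
  0<y = fromℕ-< (ℕ.n≢0⇒n>0 λ #≡0 → ℕ.<⇒≱ (ℕ.>-nonZero⁻¹ ((2 ℕ.^ j) ℕ.^ K) {{ℕ.m^n≢0 (2 ℕ.^ j) K {{ℕ.m^n≢0 2 j}}}})
    (ℕ.≤-trans dense (ℕ.≤-reflexive (cong (λ n → n ℕ.^ K ℕ.* j ℕ.^ e) (trans (cong (D ℕ.*_) #≡0) (ℕ.*-zeroʳ D))))))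

  dense-ℚ : h ^ K ℚ.≤ (fromℕ D ℚ.* y) ^ K ℚ.* fromℕ j ^ e
  dense-ℚ = begin
    h ^ K                                                  ≡⟨ fromℕ-^ (2 ℕ.^ j) K ⟨
    fromℕ ((2 ℕ.^ j) ℕ.^ K)                                ≤⟨ fromℕ-mono dense ⟩
    fromℕ ((D ℕ.* count F X) ℕ.^ K ℕ.* j ℕ.^ e)            ≡⟨ fromℕ-* ((D ℕ.* count F X) ℕ.^ K) (j ℕ.^ e) ⟩
    fromℕ ((D ℕ.* count F X) ℕ.^ K) ℚ.* fromℕ (j ℕ.^ e)    ≡⟨ cong₂ ℚ._*_ (trans (fromℕ-^ (D ℕ.* count F X) K) (cong (_^ K) (fromℕ-* D (count F X)))) (fromℕ-^ j e) ⟩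
    (fromℕ D ℚ.* y) ^ K ℚ.* fromℕ j ^ e                    ∎

  -- A rational below log X, by `½j<log`. The one half in `cD≡½` pays for the one half here, since
  -- `½ ^ K ≤ ½ ^ e`.
  ρ : ℚ
  ρ = fromℕ j ℚ.* ½

  0<ρ : 0ℚ ℚ.< ρ
  0<ρ = *-pos (fromℕ-pos j) (ℚ.positive⁻¹ ½)

  ½ᴷ≤½ᵉ : ½ ^ K ℚ.≤ ½ ^ e
  ½ᴷ≤½ᵉ = begin
    ½ ℚ.* (½ ℚ.* ½ ^ e)   ≡⟨ ℚ.*-assoc ½ ½ (½ ^ e) ⟨
    ½ ℚ.* ½ ℚ.* ½ ^ e     ≤⟨ *-monoˡ (^-nonNeg e (ℚ.<⇒≤ (ℚ.positive⁻¹ ½))) (ℚ.≤ᵇ⇒≤ {½ ℚ.* ½} {1ℚ} _) ⟩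
    1ℚ ℚ.* ½ ^ e          ≡⟨ ℚ.*-identityˡ _ ⟩
    ½ ^ e                 ∎

  ch-≤ : (c ℚ.* h) ^ K ℚ.≤ ρ ^ e ℚ.* y ^ K
  ch-≤ = begin
    (c ℚ.* h) ^ K                                          ≡⟨ ^-distrib-* c h K ⟩
    c ^ K ℚ.* h ^ K                                        ≤⟨ *-monoʳ (^-nonNeg K (ℚ.<⇒≤ 0<c)) dense-ℚ ⟩
    c ^ K ℚ.* ((fromℕ D ℚ.* y) ^ K ℚ.* fromℕ j ^ e)        ≡⟨ ℚ.*-assoc (c ^ K) _ _ ⟨
    c ^ K ℚ.* (fromℕ D ℚ.* y) ^ K ℚ.* fromℕ j ^ e          ≡⟨ cong (ℚ._* fromℕ j ^ e) (^-distrib-* c (fromℕ D ℚ.* y) K) ⟨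
    (c ℚ.* (fromℕ D ℚ.* y)) ^ K ℚ.* fromℕ j ^ e            ≡⟨ cong (λ i → i ^ K ℚ.* fromℕ j ^ e) (trans (sym (ℚ.*-assoc c (fromℕ D) y)) (cong (ℚ._* y) cD≡½)) ⟩
    (½ ℚ.* y) ^ K ℚ.* fromℕ j ^ e                          ≡⟨ cong (ℚ._* fromℕ j ^ e) (^-distrib-* ½ y K) ⟩
    ½ ^ K ℚ.* y ^ K ℚ.* fromℕ j ^ e                        ≤⟨ *-monoˡ (^-nonNeg e (ℚ.<⇒≤ (fromℕ-pos j))) (*-monoˡ (^-nonNeg K (ℚ.<⇒≤ 0<y)) ½ᴷ≤½ᵉ) ⟩
    ½ ^ e ℚ.* y ^ K ℚ.* fromℕ j ^ e                        ≡⟨ ℚ.*-comm (½ ^ e ℚ.* y ^ K) _ ⟩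
    fromℕ j ^ e ℚ.* (½ ^ e ℚ.* y ^ K)                      ≡⟨ ℚ.*-assoc (fromℕ j ^ e) _ _ ⟨
    fromℕ j ^ e ℚ.* ½ ^ e ℚ.* y ^ K                        ≡⟨ cong (ℚ._* y ^ K) (^-distrib-* (fromℕ j) ½ e) ⟨
    ρ ^ e ℚ.* y ^ K                                        ∎

  0<s : 0ℚ ℚ.< s
  0<s = ℝ⁺.positive-∉ (log X 1<X ^[ e / K ]) s∉

  -- The quotient q = c h / y satisfies q^K ≤ ρ^e with ρ < log X, hence lies below (log X)^(e/K).
  bounded : ∀ q → q ℚ.* y ≡ c ℚ.* h → q ℚ.≤ s
  bounded q qy≡ch = ℚ.≮⇒≥ λ s<q → s∉ (q , ρ , 0<q , ((1 , ℕ.≤-refl , ½j<log j) , 0<ρ) , qᴷ≤ρᵉ , s<q)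
    where
    0<q : 0ℚ ℚ.< q
    0<q = *-cancelʳ-< {q = q} 0<y (subst₂ ℚ._<_ (sym (ℚ.*-zeroˡ y)) (sym qy≡ch) (*-pos 0<c 0<h))

    qᴷ≤ρᵉ : q ^ K ℚ.≤ ρ ^ e
    qᴷ≤ρᵉ = ℚ.*-cancelʳ-≤-pos (y ^ K) {{ℚ.positive (^-pos K 0<y)}} (begin
      q ^ K ℚ.* y ^ K    ≡⟨ ^-distrib-* q y K ⟨
      (q ℚ.* y) ^ K      ≡⟨ cong (_^ K) qy≡ch ⟩
      (c ℚ.* h) ^ K      ≤⟨ ch-≤ ⟩
      ρ ^ e ℚ.* y ^ K    ∎)

  y≰p : ¬ (y ℚ.≤ p)
  y≰p y≤p = let q , qy≡ch = ÷-exists (c ℚ.* h) 0<y in ℚ.<-irrefl refl (begin-strict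
    c ℚ.* h     ≡⟨ qy≡ch ⟨
    q ℚ.* y     ≤⟨ *-monoˡ (ℚ.<⇒≤ 0<y) (bounded q qy≡ch) ⟩
    s ℚ.* y     ≡⟨ ℚ.*-comm s y ⟩
    y ℚ.* s     ≤⟨ *-monoˡ (ℚ.<⇒≤ 0<s) y≤p ⟩
    p ℚ.* s     <⟨ ps<r ⟩
    r           <⟨ r<ch ⟩
    c ℚ.* h     ∎)

-- Positive lower density and the conclusion.

^ˢ⇒ProductOf : ∀ {A} n {x} → (A ^ˢ suc n) x → ProductOf A n x
^ˢ⇒ProductOf zero    {x} x∈ = x , [] , x∈ , [] , refl , sym (ℕ.*-identityʳ x)
^ˢ⇒ProductOf (suc n) (a , y , a∈ , y∈ , refl)
  with b , xs , b∈ , xs∈ , refl , refl ← ^ˢ⇒ProductOf n y∈ = a , b ∷ xs , a∈ , b∈ ∷ xs∈ , refl , refl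

-- Some rational `q > 0` eventually lies below |P ∩ [1, n]| / n, and any `suc Q ≥ 1 / q` turns this
-- into an inequality of integers.
density⇒many : ∀ {P P′ : Pred ℕ 0ℓ} → (∀ {x} → P x → P′ x) → 0ℝ < lowerDensity P →
  ∃₂ λ Q N₀ → ∀ n .{{_ : NonZero n}} → N₀ ℕ.≤ n → Many P′ (suc Q) n
density⇒many P⇒P′ (p , (q , p<q , N₀ , q∈) , p≮0)
  with Q , 1≤Qq ← archimedean {q} (ℚ.≤-<-trans (ℚ.≮⇒≥ p≮0) p<q) = Q , N₀ , λ n N₀≤n →
  let M , (f , f-inj , f∈) , qn<M = q∈ n N₀≤n in
  M , f , f-inj , (λ i → let (_ , fi≤n) , fi∈ = f∈ i in fi≤n , P⇒P′ fi∈) , fromℕ-<⁻¹ (begin-strict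
    fromℕ n                                  ≡⟨ ℚ.*-identityˡ (fromℕ n) ⟨
    1ℚ ℚ.* fromℕ n                           ≤⟨ *-monoˡ (fromℕ-mono {0} {n} z≤n) 1≤Qq ⟩
    fromℕ (suc Q) ℚ.* q ℚ.* fromℕ n          ≡⟨ ℚ.*-assoc (fromℕ (suc Q)) q (fromℕ n) ⟩
    fromℕ (suc Q) ℚ.* (q ℚ.* fromℕ n)        <⟨ ℚ.*-monoʳ-<-pos (fromℕ (suc Q)) {{ℚ.positive (fromℕ-pos (suc Q))}} qn<M ⟩
    fromℕ (suc Q) ℚ.* fromℕ M                ≡⟨ fromℕ-* (suc Q) M ⟨
    fromℕ (suc Q ℕ.* M)                      ∎)
  where open ℚ.≤-Reasoning

theorem1p1 : (k l : ℕ) .{{_ : NonZero k}} .{{_ : NonZero l}} → l ℕ.≤ k → 2 ℕ.≤ k →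
    (A : Pred ℕ 0ℓ) → 0 ∉ A →
    0ℝ < lowerDensity (A ^ˢ k ⊕ A ^ˢ l) →
    Σ[ C ∈ ℝ⁺ ] ∀ (N : ℕ) → Σ[ X ∈ ℕ ] N ℕ.≤ X × (Σ[ 1<X ∈ 1 ℕ.< X ]
    real (C * √ (fromℕ⁺ X (<⇒≤ 1<X)) ÷ log X 1<X ^[ k ℕ.+ l ℕ.∸ 2 / k ℕ.+ l ]) ≤ ∣ A ∩[1, X ]∣)
theorem1p1 (suc κ) (suc μ) _ _ A 0∉A density =
  let
    Q , N₀ , many = density⇒many {P = A ^ˢ suc κ ⊕ A ^ˢ suc μ} {P′ = SumOfProducts A κ μ}
      (λ (y , z , y∈ , z∈ , eq) → y , z , ^ˢ⇒ProductOf κ y∈ , ^ˢ⇒ProductOf μ z∈ , eq) density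
    0<D = fromℕ-pos (densityConstant (κ ℕ.+ μ) (suc Q)) {{densityConstant≢0 (κ ℕ.+ μ) (suc Q)}}
    -- The constant C is 1 / (2 D) for the density constant D.
    c , cD≡½ = ÷-exists ½ 0<D
    0<c = *-cancelʳ-< {q = c} 0<D (subst₂ ℚ._<_ (sym (ℚ.*-zeroˡ (fromℕ (densityConstant (κ ℕ.+ μ) (suc Q))))) (sym cD≡½) (ℚ.positive⁻¹ ½))
  in
  record { real = fromℚ c ; positive = 0<c } , λ N →
  let
    -- `suc N₀` keeps `n` nonzero, and `suc N` makes `j` positive, so that `X = 4 ^ j` exceeds 1.
    j , N<j , dense = many⇒dense 0∉A κ μ (suc Q) (suc N₀)
      (λ n N₀<n → many n {{ℕ.>-nonZero (ℕ.≤-trans (s≤s z≤n) N₀<n)}} (<⇒≤ N₀<n)) (suc N)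
    0<j = ℕ.≤-trans (s≤s z≤n) N<j
    1<X = ℕ.^-monoʳ-< 4 (s≤s (s≤s z≤n)) {0} {j} 0<j
  in
  4 ℕ.^ j , ℕ.≤-trans (<⇒≤ N<j) (ℕ.≤-trans (<⇒≤ (n<2^n j)) (ℕ.^-monoˡ-≤ j (s≤s (s≤s z≤n)))) , 1<X ,
  dense⇒large {D = densityConstant (κ ℕ.+ μ) (suc Q)} c 0<c (κ ℕ.+ suc μ ℕ.∸ 1) (suc κ ℕ.+ suc μ) (cong (ℕ._∸ 1) (ℕ.+-suc κ μ)) (cong suc (ℕ.+-suc κ μ))
    0∉A cD≡½ {{ℕ.>-nonZero 0<j}} 1<X dense
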